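{- Let $k\geq 1$. The generating function of the cube polynomials $C_{M_{n,k}}(x)$ of the Munarini graphs is $$\sum_{n\geq 0} C_{M_{n,k}}(x)\,t^n=\frac{1}{1-kt-(k-1)xt-(1+x)t^2}$$ as formal power series in $t$ with coefficients in $\mathbb{Z}[x]$.
   Context: For integers $k\geq 1$, $n\geq 0$, a $k$-generalized Pell string of length $n$ is a word of length $n$ over the alphabet $\{0,1,\ldots,k\}$ in which every maximal run of the character $k$ has even length (equivalently, a concatenation of letters from $\{0,1,\ldots,k-1,kk\}$). Let $\mathcal{F}_{n,k}$ be the set of these strings (for $n=0$ it contains only the empty string). The Munarini graph $M_{n,k}$ is the simple graph with vertex set $\mathcal{F}_{n,k}$ in which two vertices are adjacent if one of them can be obtained from the other either by replacing one occurrence of $0$ with some $i\in\{1,\ldots,k-1\}$, or by replacing one substring $00$ (two consecutive positions) with $kk$ (both replacements may be read in either direction, and both strings must be in $\mathcal{F}_{n,k}$). For a finite graph $G$, the cube polynomial is $C_G(x)=\sum_{p\geq 0}c_p(G)x^p$, where $c_p(G)$ is the number of induced subgraphs of $G$ isomorphic to the $p$-dimensional hypercube $Q_p$ ($Q_0=K_1$). -}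

module Defs where

open import Data.Bool.Base using (Bool; true; false)
import Data.Bool.Properties as Bool
open import Data.Fin.Base using (Fin; zero; suc; fromℕ; toℕ)
open import Data.Fin.Properties as Fin using (any?; all?; toℕ-fromℕ; injective⇒≤)
open import Data.Fin.Subset using (Subset; _∈_)
open import Data.Fin.Subset.Properties using (_∈?_; anySubset?)
open import Data.Integer.Base as ℤ using (ℤ; +_; 0ℤ; 1ℤ)
open import Data.Irrelevant using ([_])
open import Data.List.Base as List using (List; []; _∷_; _++_; replicate; head; last; length; filter; cartesianProductWith; allFin; applyUpTo; foldr; upTo)
open import Data.List.Membership.Propositional using () renaming (_∈_ to _∈ₗ_)
open import Data.List.Membership.Propositional.Properties using (∈-filter⁺; ∈-cartesianProductWith⁺; ∈-allFin; ∈-lookup)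
import Data.List.Properties as List
open import Data.List.Relation.Unary.All as All using ([])
open import Data.List.Relation.Unary.All.Properties using (all-filter)
open import Data.List.Relation.Unary.AllPairs using ([]; _∷_)
open import Data.List.Relation.Unary.Any as Any using (here; there)
open import Data.List.Relation.Unary.Any.Properties using (lookup-index)
open import Data.List.Relation.Unary.Unique.Propositional using (Unique)
import Data.List.Relation.Unary.Unique.Propositional.Properties as Unique
open import Data.Maybe.Base using (just)
open import Data.Maybe.Properties using (just-injective)
open import Data.Nat.Base using (ℕ; zero; suc; _∸_; _≤_; s≤s; NonZero; ≢-nonZero⁻¹)
open import Data.Nat.Divisibility using (_∣_; _∣0; _∣?_; ∣m∣n⇒∣m+n; ∣m+n∣m⇒∣n; ∣-refl)
open import Data.Product using (∃; _×_; _,_; proj₁; proj₂)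
open import Data.Refinement using (Refinement-syntax; value; value-injective; _,_)
open import Data.Sum.Base using (_⊎_; inj₁; inj₂; swap)
open import Data.Vec.Base as Vec using (Vec; []; _∷_; lookup; toList)
open import Data.Vec.Properties using (∷-injective; ≡-dec)
open import Function.Base using (_∘_; const)
open import Function.Bundles using (_↔_; _⇔_; mk↔ₛ′; mk⇔; Inverse; Equivalence)
open import Level using (0ℓ)
open import Relation.Binary.Core using (Rel)
open import Relation.Binary.Definitions using (Decidable; Symmetric; Irreflexive; DecidableEquality)
open import Relation.Binary.PropositionalEquality using (_≡_; _≢_; _≗_; refl; sym; trans; cong; subst; subst₂)
open import Relation.Nullary using (¬_; Dec; yes; no; contradiction; recompute)
open import Relation.Nullary.Decidable as Dec using (map′; ¬?; _×-dec_; _⊎-dec_; _→-dec_; decidable-stable)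
import Relation.Unary as U

record Graph : Set₁ where
  field
    Vertex     : Set
    Adj        : Rel Vertex 0ℓ
    Adj-sym    : Symmetric Adj
    Adj-irrefl : Irreflexive _≡_ Adj

record FiniteGraph : Set₁ where
  field
    graph : Graph
  open Graph graph public
  field
    order : ℕ
    index : Vertex ↔ Fin order
    Adj?  : Decidable Adj

infix 4 _≅_

record _≅_ (G H : Graph) : Set where
  private
    module G = Graph G
    module H = Graph H
  field
    bijection : G.Vertex ↔ H.Vertex
    adjacency : ∀ u v → G.Adj u v ⇔ H.Adj (Inverse.to bijection u) (Inverse.to bijection v)

-- An induced subgraph is determined by its vertex set, given here as a
-- subset of the indices of the vertices.
induced : (G : FiniteGraph) → Subset (FiniteGraph.order G) → Graph
induced G S = record
  { Vertex     = [ v ∈ G.Vertex ∣ Inverse.to G.index v ∈ S ]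
  ; Adj        = λ u v → G.Adj (value u) (value v)
  ; Adj-sym    = G.Adj-sym
  ; Adj-irrefl = λ { refl → G.Adj-irrefl refl }
  }
  where module G = FiniteGraph G

hypercube : ℕ → Graph
hypercube p = record
  { Vertex     = Vec Bool p
  ; Adj        = λ u v → ∃ λ i → lookup u i ≢ lookup v i × (∀ j → j ≢ i → lookup u j ≡ lookup v j)
  ; Adj-sym    = λ { (i , ≢i , ≡j) → i , ≢i ∘ sym , λ j j≢i → sym (≡j j j≢i) }
  ; Adj-irrefl = λ { refl (i , ≢i , _) → ≢i refl }
  }

private

  allBits? : ∀ {p} {P : U.Pred (Vec Bool p) 0ℓ} → U.Decidable P → Dec (∀ u → P u)
  allBits? P? = map′ (λ ∄ u → decidable-stable (P? u) (λ ¬Pu → ∄ (u , ¬Pu)))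
                     (λ ∀P (u , ¬Pu) → ¬Pu (∀P u))
                     (¬? (anySubset? (¬? ∘ P?)))

  join : ∀ {A : Set} {p} → (Vec Bool p → A) → (Vec Bool p → A) → Vec Bool (suc p) → A
  join f g (true  ∷ u) = f u
  join f g (false ∷ u) = g u

  anyFunction? : ∀ {N} p {P : (Vec Bool p → Fin N) → Set} →
                 (∀ {f g} → f ≗ g → P f → P g) → (∀ f → Dec (P f)) → Dec (∃ P)
  anyFunction? zero resp P? =
    map′ (λ (i , Pi) → const i , Pi)
         (λ (f , Pf) → f [] , resp (λ { [] → refl }) Pf)
         (any? (λ i → P? (const i)))
  anyFunction? (suc p) resp P? =
    map′ (λ (f , g , Pfg) → join f g , Pfg)
         (λ (h , Ph) → h ∘ (true ∷_) , h ∘ (false ∷_) ,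
                       resp (λ { (true ∷ u) → refl ; (false ∷ u) → refl }) Ph)
         (anyFunction? p
            (λ f≗f′ (g , Pfg) → g , resp (λ { (true ∷ u) → f≗f′ u ; (false ∷ u) → refl }) Pfg)
            (λ f → anyFunction? p
               (λ g≗g′ → resp (λ { (true ∷ u) → refl ; (false ∷ u) → g≗g′ u }))
               (λ g → P? (join f g))))

  ⇔-dec : ∀ {A B : Set} → Dec A → Dec B → Dec (A ⇔ B)
  ⇔-dec a? b? = map′ (λ (f , g) → mk⇔ f g) (λ e → Equivalence.to e , Equivalence.from e)
                     ((a? →-dec b?) ×-dec (b? →-dec a?))

  module _ (G : FiniteGraph) (p : ℕ) (S : Subset (FiniteGraph.order G)) where
    private
      module G = FiniteGraph G
      module Q = Graph (hypercube p)
      module I = Inverse G.index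

    Adjᵢ : Rel (Fin G.order) 0ℓ
    Adjᵢ i j = G.Adj (I.from i) (I.from j)

    IsParametrisation : (Vec Bool p → Fin G.order) → Set
    IsParametrisation f =
      (∀ u v → f u ≡ f v → u ≡ v) ×
      (∀ u → f u ∈ S) ×
      (∀ i → i ∈ S → ∃ λ u → f u ≡ i) ×
      (∀ u v → Q.Adj u v ⇔ Adjᵢ (f u) (f v))

    resp : ∀ {f g} → f ≗ g → IsParametrisation f → IsParametrisation g
    resp f≗g (inj , into , onto , adj) =
      (λ u v gu≡gv → inj u v (trans (f≗g u) (trans gu≡gv (sym (f≗g v))))) ,
      (λ u → subst (_∈ S) (f≗g u) (into u)) ,
      (λ i i∈S → let (u , fu≡i) = onto i i∈S in u , trans (sym (f≗g u)) fu≡i) ,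
      (λ u v → subst₂ (λ i j → Q.Adj u v ⇔ Adjᵢ i j) (f≗g u) (f≗g v) (adj u v))

    isParametrisation? : ∀ f → Dec (IsParametrisation f)
    isParametrisation? f =
      (allBits? λ u → allBits? λ v → (f u Fin.≟ f v) →-dec ≡-dec Bool._≟_ u v) ×-dec
      (allBits? λ u → f u ∈? S) ×-dec
      (all? λ i → (i ∈? S) →-dec anySubset? (λ u → f u Fin.≟ i)) ×-dec
      (allBits? λ u → allBits? λ v → ⇔-dec (Q-Adj? u v) (G.Adj? (I.from (f u)) (I.from (f v))))
      where
      Q-Adj? : Decidable Q.Adj
      Q-Adj? u v = any? λ i → ¬? (lookup u i Bool.≟ lookup v i) ×-dec
                              all? (λ j → ¬? (j Fin.≟ i) →-dec (lookup u j Bool.≟ lookup v j))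

    to-≅ : ∃ IsParametrisation → induced G S ≅ hypercube p
    to-≅ (f , inj , into , onto , adj) = record
      { bijection = mk↔ₛ′ to from to∘from from∘to
      ; adjacency = λ u v → mk⇔
          (λ a → Equivalence.from (adj (to u) (to v)) (subst₂ G.Adj (sym (from-to u)) (sym (from-to v)) a))
          (λ a → subst₂ G.Adj (from-to u) (from-to v) (Equivalence.to (adj (to u) (to v)) a))
      }
      where
      pre : (v : Graph.Vertex (induced G S)) → ∃ λ u → f u ≡ I.to (value v)
      pre (v , [ v∈S ]) = onto (I.to v) (recompute (I.to v ∈? S) v∈S)

      to : Graph.Vertex (induced G S) → Vec Bool p
      to v = proj₁ (pre v)

      from : Vec Bool p → Graph.Vertex (induced G S)
      from u = I.from (f u) , [ subst (_∈ S) (sym (I.strictlyInverseˡ (f u))) (into u) ]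

      from-to : ∀ v → I.from (f (to v)) ≡ value v
      from-to v = trans (cong I.from (proj₂ (pre v))) (I.strictlyInverseʳ (value v))

      to∘from : ∀ u → to (from u) ≡ u
      to∘from u = inj _ u (trans (proj₂ (pre (from u))) (I.strictlyInverseˡ (f u)))

      from∘to : ∀ v → from (to v) ≡ v
      from∘to v = value-injective (from-to v)

    from-≅ : induced G S ≅ hypercube p → ∃ IsParametrisation
    from-≅ iso = f , inj , into , onto , adj
      where
      open _≅_ iso
      module B = Inverse bijection

      f : Vec Bool p → Fin G.order
      f u = I.to (value (B.from u))

      from∘f : ∀ u → I.from (f u) ≡ value (B.from u)
      from∘f u = I.strictlyInverseʳ (value (B.from u))

      inj : ∀ u v → f u ≡ f v → u ≡ v
      inj u v fu≡fv = trans (sym (B.strictlyInverseˡ u)) (trans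
        (cong B.to (value-injective (trans (sym (from∘f u)) (trans (cong I.from fu≡fv) (from∘f v)))))
        (B.strictlyInverseˡ v))

      into : ∀ u → f u ∈ S
      into u with B.from u
      ... | v , [ v∈S ] = recompute (I.to v ∈? S) v∈S

      onto : ∀ i → i ∈ S → ∃ λ u → f u ≡ i
      onto i i∈S = B.to v , trans (cong (I.to ∘ value) (B.strictlyInverseʳ v)) (I.strictlyInverseˡ i)
        where
        v : Graph.Vertex (induced G S)
        v = I.from i , [ subst (_∈ S) (sym (I.strictlyInverseˡ i)) i∈S ]

      adj : ∀ u v → Q.Adj u v ⇔ Adjᵢ (f u) (f v)
      adj u v = mk⇔
        (λ a → subst₂ G.Adj (sym (from∘f u)) (sym (from∘f v))
                 (Equivalence.from e (subst₂ Q.Adj (sym (B.strictlyInverseˡ u)) (sym (B.strictlyInverseˡ v)) a)))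
        (λ a → subst₂ Q.Adj (B.strictlyInverseˡ u) (B.strictlyInverseˡ v)
                 (Equivalence.to e (subst₂ G.Adj (from∘f u) (from∘f v) a)))
        where e = adjacency (B.from u) (B.from v)

induced≅hypercube? : (G : FiniteGraph) (p : ℕ) (S : Subset (FiniteGraph.order G)) →
                     Dec (induced G S ≅ hypercube p)
induced≅hypercube? G p S =
  map′ (to-≅ G p S) (from-≅ G p S) (anyFunction? p (resp G p S) (isParametrisation? G p S))

allVecs : ∀ {A : Set} → List A → (n : ℕ) → List (Vec A n)
allVecs xs zero    = [] ∷ []
allVecs xs (suc n) = cartesianProductWith _∷_ xs (allVecs xs n)

∈-allVecs : ∀ {A : Set} {xs : List A} → (∀ x → x ∈ₗ xs) → ∀ {n} (v : Vec A n) → v ∈ₗ allVecs xs n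
∈-allVecs complete []      = here refl
∈-allVecs complete (x ∷ v) = ∈-cartesianProductWith⁺ _∷_ (complete x) (∈-allVecs complete v)

allVecs-unique : ∀ {A : Set} {xs : List A} → Unique xs → ∀ n → Unique (allVecs xs n)
allVecs-unique xs! zero    = [] ∷ []
allVecs-unique xs! (suc n) = Unique.cartesianProductWith⁺ _∷_ ∷-injective xs! (allVecs-unique xs! n)

private

  lookup-injective : ∀ {A : Set} {xs : List A} → Unique xs →
                     ∀ i j → List.lookup xs i ≡ List.lookup xs j → i ≡ j
  lookup-injective (x∉ ∷ xs!) zero    zero    eq = refl
  lookup-injective (x∉ ∷ xs!) zero    (suc j) eq = contradiction eq (All.lookup x∉ (∈-lookup j))
  lookup-injective (x∉ ∷ xs!) (suc i) zero    eq = contradiction (sym eq) (All.lookup x∉ (∈-lookup i))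
  lookup-injective (x∉ ∷ xs!) (suc i) (suc j) eq = cong suc (lookup-injective xs! i j eq)

refinement↔Fin : ∀ {A : Set} {P : U.Pred A 0ℓ} (P? : U.Decidable P) {xs : List A} →
                 Unique xs → (∀ x → x ∈ₗ xs) →
                 [ x ∈ A ∣ P x ] ↔ Fin (length (filter P? xs))
refinement↔Fin {A} {P} P? {xs} xs! complete = mk↔ₛ′ to from to∘from from∘to
  where
  mem : (v : [ x ∈ A ∣ P x ]) → value v ∈ₗ filter P? xs
  mem (x , [ px ]) = ∈-filter⁺ P? (complete x) (recompute (P? x) px)

  to : [ x ∈ A ∣ P x ] → Fin (length (filter P? xs))
  to v = Any.index (mem v)

  from : Fin (length (filter P? xs)) → [ x ∈ A ∣ P x ]
  from i = List.lookup (filter P? xs) i , [ All.lookup (all-filter P? xs) (∈-lookup i) ]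

  to∘from : ∀ i → to (from i) ≡ i
  to∘from i = lookup-injective (Unique.filter⁺ P? xs!) _ i (sym (lookup-index (mem (from i))))

  from∘to : ∀ v → from (to v) ≡ v
  from∘to v = value-injective (sym (lookup-index (mem v)))

allSubsets : (n : ℕ) → List (Subset n)
allSubsets = allVecs (true ∷ false ∷ [])

-- Coefficient lists, constant term first; trailing zeros are allowed, so
-- equality of polynomials is _≈ₚ_.
Poly : Set
Poly = List ℤ

coeff : Poly → ℕ → ℤ
coeff []      _       = 0ℤ
coeff (a ∷ _) zero    = a
coeff (_ ∷ f) (suc i) = coeff f i

infix  4 _≈ₚ_
infixl 6 _+ₚ_
infixl 7 _*ₚ_
infix  8 -ₚ_

_≈ₚ_ : Rel Poly 0ℓ
f ≈ₚ g = ∀ i → coeff f i ≡ coeff g i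

0ₚ 1ₚ X : Poly
0ₚ = []
1ₚ = 1ℤ ∷ []
X  = 0ℤ ∷ 1ℤ ∷ []

constₚ : ℤ → Poly
constₚ a = a ∷ []

_+ₚ_ : Poly → Poly → Poly
[]      +ₚ g       = g
(a ∷ f) +ₚ []      = a ∷ f
(a ∷ f) +ₚ (b ∷ g) = a ℤ.+ b ∷ f +ₚ g

-ₚ_ : Poly → Poly
-ₚ f = List.map (λ a → ℤ.- a) f

_*ₚ_ : Poly → Poly → Poly
[]      *ₚ g = []
(a ∷ f) *ₚ g = List.map (a ℤ.*_) g +ₚ (0ℤ ∷ f *ₚ g)

PowerSeries : Set
PowerSeries = ℕ → Poly

infix  4 _≈_
infixl 6 _-_
infixl 7 _*_

_≈_ : Rel PowerSeries 0ℓ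
F ≈ G = ∀ n → F n ≈ₚ G n

constₛ : Poly → PowerSeries
constₛ f zero    = f
constₛ f (suc _) = 0ₚ

1ₛ t : PowerSeries
1ₛ = constₛ 1ₚ
t 1 = 1ₚ
t _ = 0ₚ

_-_ : PowerSeries → PowerSeries → PowerSeries
(F - G) n = F n +ₚ -ₚ G n

_*_ : PowerSeries → PowerSeries → PowerSeries
(F * G) n = foldr _+ₚ_ 0ₚ (List.map (λ i → F i *ₚ G (n ∸ i)) (upTo (suc n)))

-- In a commutative ring, F = 1 / D means that F is the (unique) inverse of D.
infix 4 _≈1/_
_≈1/_ : Rel PowerSeries 0ℓ
F ≈1/ D = D * F ≈ 1ₛ

cubeCount : FiniteGraph → ℕ → ℕ
cubeCount G p = length (filter (induced≅hypercube? G p) (allSubsets (FiniteGraph.order G)))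

-- Terms of degree p ≥ order G are omitted; they vanish because
-- the hypercube of dimension p has more than p vertices, see
-- coeff-cubePolynomial.
cubePolynomial : FiniteGraph → Poly
cubePolynomial G = applyUpTo (λ p → + cubeCount G p) (FiniteGraph.order G)

private

  prefix : ∀ {p} → Fin (suc p) → Vec Bool p
  prefix {zero}  _       = []
  prefix {suc p} zero    = Vec.replicate (suc p) false
  prefix {suc p} (suc i) = true ∷ prefix i

  prefix-injective : ∀ {p} (i j : Fin (suc p)) → prefix i ≡ prefix j → i ≡ j
  prefix-injective {zero}  zero    zero    eq = refl
  prefix-injective {suc p} zero    zero    eq = refl
  prefix-injective {suc p} (suc i) (suc j) eq = cong suc (prefix-injective i j (proj₂ (∷-injective eq)))

  cube⇒<order : ∀ G p S → induced G S ≅ hypercube p → suc p ≤ FiniteGraph.order G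
  cube⇒<order G p S iso with from-≅ G p S iso
  ... | f , inj , _ = injective⇒≤ {f = f ∘ prefix} (λ {i} {j} eq → prefix-injective i j (inj _ _ eq))

  coeff-applyUpTo : ∀ (c : ℕ → ℕ) m → (∀ p → ¬ (suc p ≤ m) → c p ≡ 0) →
                    ∀ p → coeff (applyUpTo (λ q → + c q) m) p ≡ + c p
  coeff-applyUpTo c zero    vanish p       = cong +_ (sym (vanish p λ ()))
  coeff-applyUpTo c (suc m) vanish zero    = refl
  coeff-applyUpTo c (suc m) vanish (suc p) =
    coeff-applyUpTo (c ∘ suc) m (λ q q≮m → vanish (suc q) λ { (s≤s q<m) → q≮m q<m }) p

coeff-cubePolynomial : ∀ G p → coeff (cubePolynomial G) p ≡ + cubeCount G p
coeff-cubePolynomial G = coeff-applyUpTo (cubeCount G) (FiniteGraph.order G) λ p p≮ →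
  cong length (List.filter-none (induced≅hypercube? G p)
    (All.universal (λ S iso → p≮ (cube⇒<order G p S iso)) (allSubsets (FiniteGraph.order G))))

Word : ℕ → ℕ → Set
Word k n = Vec (Fin (suc k)) n

-- A maximal run is a factor consisting of letters k that is neither
-- preceded nor followed by a letter k (empty runs are harmless).
IsPell : ∀ {k n} → Word k n → Set
IsPell {k} w = ∀ u m v → toList w ≡ u ++ replicate m (fromℕ k) ++ v →
               last u ≢ just (fromℕ k) → head v ≢ just (fromℕ k) → 2 ∣ m

-- The description as concatenations over {0,…,k-1,kk}; equivalent to IsPell
-- and used only to decide it.
data Concat {k : ℕ} : ∀ {n} → Word k n → Set where
  []     : Concat []
  letter : ∀ {n a} {w : Word k n} → a ≢ fromℕ k → Concat w → Concat (a ∷ w)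
  pair   : ∀ {n} {w : Word k n} → Concat w → Concat (fromℕ k ∷ fromℕ k ∷ w)

private

  2∣2+ : ∀ {m} → 2 ∣ m → 2 ∣ suc (suc m)
  2∣2+ = ∣m∣n⇒∣m+n ∣-refl

  last-∷ : ∀ {A : Set} {x z : A} u → last (x ∷ u) ≢ just z → last u ≢ just z
  last-∷ []      _ = λ ()
  last-∷ (_ ∷ _) h = h

  last-∷⁻ : ∀ {A : Set} {x z : A} u → x ≢ z → last u ≢ just z → last (x ∷ u) ≢ just z
  last-∷⁻ []      x≢z _ = x≢z ∘ just-injective
  last-∷⁻ (_ ∷ _) _   h = h

Concat⇒IsPell : ∀ {k n} {w : Word k n} → Concat w → IsPell w
Concat⇒IsPell []           []          zero          v eq lu hv = 2 ∣0
Concat⇒IsPell (letter a≢ c) []         zero          v eq lu hv = 2 ∣0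
Concat⇒IsPell (letter a≢ c) []         (suc m)       v eq lu hv = contradiction (List.∷-injectiveˡ eq) a≢
Concat⇒IsPell (letter a≢ c) (x ∷ u)    m             v eq lu hv =
  Concat⇒IsPell c u m v (List.∷-injectiveʳ eq) (last-∷ u lu) hv
Concat⇒IsPell (pair c)     []          zero          v eq lu hv = 2 ∣0
Concat⇒IsPell (pair c)     []          (suc zero)    v eq lu hv =
  contradiction (sym (cong head (List.∷-injectiveʳ eq))) hv
Concat⇒IsPell (pair c)     []          (suc (suc m)) v eq lu hv =
  2∣2+ (Concat⇒IsPell c [] m v (List.∷-injectiveʳ (List.∷-injectiveʳ eq)) lu hv)
Concat⇒IsPell (pair c)     (x ∷ [])    m             v eq lu hv =
  contradiction (cong just (sym (List.∷-injectiveˡ eq))) lu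
Concat⇒IsPell (pair c)     (x ∷ y ∷ u) m             v eq lu hv =
  Concat⇒IsPell c u m v (List.∷-injectiveʳ (List.∷-injectiveʳ eq)) (last-∷ u lu) hv

IsPell⇒Concat : ∀ {k n} (w : Word k n) → IsPell w → Concat w
IsPell⇒Concat []      h = []
IsPell⇒Concat {k} (a ∷ w) h with a Fin.≟ fromℕ k
IsPell⇒Concat {k} (a ∷ w) h | no a≢ = letter a≢ (IsPell⇒Concat w λ u m v eq lu hv →
  h (a ∷ u) m v (cong (a ∷_) eq) (last-∷⁻ u a≢ lu) hv)
IsPell⇒Concat {k} (a ∷ []) h | yes refl =
  contradiction (h [] 1 [] refl (λ ()) (λ ())) (Dec.from-no (2 ∣? 1))
IsPell⇒Concat {k} (a ∷ b ∷ w) h | yes refl with b Fin.≟ fromℕ k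
... | no b≢ = contradiction (h [] 1 (b ∷ toList w) refl (λ ()) (b≢ ∘ just-injective)) (Dec.from-no (2 ∣? 1))
... | yes refl = pair (IsPell⇒Concat w h′)
  where
  h′ : IsPell w
  h′ []      m v eq lu hv = ∣m+n∣m⇒∣n (h [] (suc (suc m)) v (cong (λ l → a ∷ a ∷ l) eq) lu hv) ∣-refl
  h′ (x ∷ u) m v eq lu hv = h (a ∷ a ∷ x ∷ u) m v (cong (λ l → a ∷ a ∷ l) eq) lu hv

private

  concat? : ∀ {k n} (w : Word k n) → Dec (Concat w)
  concat? [] = yes []
  concat? {k} (a ∷ w) with a Fin.≟ fromℕ k
  concat? {k} (a ∷ w) | no a≢ = map′ (letter a≢) (λ { (letter _ c) → c ; (pair _) → contradiction refl a≢ }) (concat? w)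
  concat? {k} (a ∷ []) | yes refl = no λ { (letter a≢ _) → a≢ refl }
  concat? {k} (a ∷ b ∷ w) | yes refl with b Fin.≟ fromℕ k
  ... | no b≢ = no λ { (letter a≢ _) → a≢ refl ; (pair _) → b≢ refl }
  ... | yes refl = map′ pair (λ { (letter a≢ _) → contradiction refl a≢ ; (pair c) → c }) (concat? w)

isPell? : ∀ {k n} → U.Decidable (IsPell {k} {n})
isPell? w = map′ Concat⇒IsPell (IsPell⇒Concat w) (concat? w)

PellString : ℕ → ℕ → Set
PellString n k = [ w ∈ Word k n ∣ IsPell w ]

infix 4 _⟶_

-- One replacement 0 ↦ i with 1 ≤ i ≤ k-1, or 00 ↦ kk, at some position.
data _⟶_ {k : ℕ} : ∀ {n} → Rel (Word k n) 0ℓ where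
  single : ∀ {n} {w : Word k n} {i} → i ≢ zero → i ≢ fromℕ k → zero ∷ w ⟶ i ∷ w
  double : ∀ {n} {w : Word k n} → zero ∷ zero ∷ w ⟶ fromℕ k ∷ fromℕ k ∷ w
  there  : ∀ {n} {u v : Word k n} {a} → u ⟶ v → a ∷ u ⟶ a ∷ v

private

  ⟶-irrefl : ∀ {k n} .{{_ : NonZero k}} {u v : Word k n} → u ⟶ v → u ≢ v
  ⟶-irrefl (single i≢0 _) eq = i≢0 (sym (proj₁ (∷-injective eq)))
  ⟶-irrefl {k} double     eq = ≢-nonZero⁻¹ k (trans (sym (toℕ-fromℕ k)) (cong toℕ (sym (proj₁ (∷-injective eq)))))
  ⟶-irrefl (there s)      eq = ⟶-irrefl s (proj₂ (∷-injective eq))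

  infix 4 _≟ʷ_ _⟶?_

  _≟ʷ_ : ∀ {k n} → DecidableEquality (Word k n)
  _≟ʷ_ = ≡-dec Fin._≟_

  _⟶?_ : ∀ {k n} → Decidable (_⟶_ {k} {n})
  [] ⟶? [] = no λ ()
  _⟶?_ {k} (a ∷ []) (b ∷ []) =
    map′ (λ { (refl , b≢0 , b≢k) → single b≢0 b≢k })
         (λ { (single b≢0 b≢k) → refl , b≢0 , b≢k ; (there ()) })
         (a Fin.≟ zero ×-dec ¬? (b Fin.≟ zero) ×-dec ¬? (b Fin.≟ fromℕ k))
  _⟶?_ {k} (a ∷ c ∷ u) (b ∷ d ∷ v) =
    map′ (λ { (inj₁ (refl , b≢0 , b≢k , refl)) → single b≢0 b≢k
            ; (inj₂ (inj₁ (refl , refl , refl , refl , refl))) → double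
            ; (inj₂ (inj₂ (refl , s))) → there s })
         (λ { (single b≢0 b≢k) → inj₁ (refl , b≢0 , b≢k , refl)
            ; double → inj₂ (inj₁ (refl , refl , refl , refl , refl))
            ; (there s) → inj₂ (inj₂ (refl , s)) })
         ((a Fin.≟ zero ×-dec ¬? (b Fin.≟ zero) ×-dec ¬? (b Fin.≟ fromℕ k) ×-dec (c ∷ u) ≟ʷ (d ∷ v))
          ⊎-dec (a Fin.≟ zero ×-dec c Fin.≟ zero ×-dec b Fin.≟ fromℕ k ×-dec d Fin.≟ fromℕ k ×-dec u ≟ʷ v)
          ⊎-dec (a Fin.≟ b ×-dec ((c ∷ u) ⟶? (d ∷ v))))

munarini : (n k : ℕ) → .{{NonZero k}} → FiniteGraph
munarini n k = record
  { graph = record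
    { Vertex     = PellString n k
    ; Adj        = λ u v → value u ⟶ value v ⊎ value v ⟶ value u
    ; Adj-sym    = swap
    ; Adj-irrefl = λ { refl (inj₁ s) → ⟶-irrefl s refl ; refl (inj₂ s) → ⟶-irrefl s refl }
    }
  ; order = length (filter isPell? (allVecs (allFin (suc k)) n))
  ; index = refinement↔Fin isPell? (allVecs-unique (Unique.allFin⁺ (suc k)) n) (∈-allVecs ∈-allFin)
  ; Adj?  = λ u v → (value u ⟶? value v) ⊎-dec (value v ⟶? value u)
  }

{-# OPTIONS --safe #-}
module Submission where

-- A Pell string over k = m + 1 splits uniquely into letters and pairs kk, so it
-- amounts to the set of its nonzero blocks (a letter i or a pair kk at a given
-- position), and two strings are adjacent exactly when these sets differ by one
-- block.  This embeds the Munarini graph into a hypercube, where opposite edges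
-- of a 4-cycle flip the same block.  Hence all edges between two opposite faces
-- of an induced cube add one and the same block, and by induction on the
-- dimension an induced cube is the same as a word over the letters 0,…,k-1, kk
-- (which fix a block) and 0|i, 00|kk (which span a direction of the cube).
-- Reading off the first symbol of such words gives the recurrence encoded by the
-- denominator.

open import Defs
open import Data.Bool.Base using (Bool; true; false; not)
import Data.Bool.Properties as Bool
open import Data.Fin.Base using (Fin; zero; suc; fromℕ; inject₁)
open import Data.Fin.Properties as Fin using (fromℕ≢inject₁; inject₁-injective)
open import Data.Fin.Relation.Unary.Top using (view; ‵fromℕ; ‵inject₁)
open import Data.Fin.Subset using (Subset) renaming (_∈_ to _∈ˢ_)
open import Data.Fin.Subset.Properties using (_∈?_; anySubset?; ⊆-antisym)
open import Data.Integer.Base as ℤ using (ℤ; +_; 0ℤ; 1ℤ; -1ℤ)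
import Data.Integer.Properties as ℤ
open import Data.Integer.Tactic.RingSolver using (solve-∀)
open import Data.Irrelevant using ([_])
open import Data.List.Base as List using (List; []; _∷_; _++_; length; map; filter; cartesianProductWith; allFin; foldr; applyUpTo)
open import Data.List.Membership.Propositional using () renaming (_∈_ to _∈ₗ_)
open import Data.List.Membership.Propositional.Properties using (∈-filter⁺; ∈-filter⁻; ∈-map⁺; ∈-map⁻; ∈-++⁺ˡ; ∈-++⁺ʳ; ∈-++⁻; ∈-cartesianProductWith⁺; ∈-cartesianProductWith⁻; ∈-allFin)
open import Data.List.Membership.Propositional.Properties.WithK using (unique∧set⇒bag)
open import Data.List.Properties using (length-map; length-++; length-tabulate)
open import Data.List.Relation.Binary.BagAndSetEquality using (∼bag⇒↭)
open import Data.List.Relation.Binary.Disjoint.Propositional using (Disjoint)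
open import Data.List.Relation.Binary.Permutation.Propositional.Properties using (↭-length)
open import Data.List.Relation.Unary.All using ([]; _∷_)
open import Data.List.Relation.Unary.AllPairs using ([]; _∷_)
open import Data.List.Relation.Unary.Any using (here; there)
open import Data.List.Relation.Unary.Unique.Propositional using (Unique)
import Data.List.Relation.Unary.Unique.Propositional.Properties as Unique
open import Data.Nat.Base using (ℕ; zero; suc; NonZero; _+_; _∸_) renaming (_*_ to _·_)
open import Data.Product using (∃; _×_; _,_; proj₁; proj₂)
open import Data.Refinement using (value; value-injective; _,_)
open import Data.Sum.Base as Sum using (_⊎_; inj₁; inj₂)
open import Data.Vec.Base as Vec using (Vec; []; _∷_; lookup; tabulate; replicate)
open import Data.Vec.Properties using (≡-dec; ∷-injectiveˡ; ∷-injectiveʳ; lookup∘tabulate; tabulate∘lookup; tabulate-cong; []=⇒lookup; lookup⇒[]=)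
open import Function.Base using (_∘_; id)
open import Function.Bundles using (_↔_; _⇔_; mk↔ₛ′; mk⇔; Inverse; Equivalence)
open import Function.Construct.Composition using (_↔-∘_)
open import Relation.Binary.Definitions using (DecidableEquality)
open import Relation.Binary.PropositionalEquality using (_≡_; _≢_; refl; sym; trans; cong; cong₂; subst; subst₂; module ≡-Reasoning)
open import Relation.Nullary using (¬_; Dec; yes; no; does; contradiction; recompute)
open import Relation.Nullary.Decidable using (map′; dec-true; dec-false)
import Relation.Unary as U

-- Blocks that overlap exclude each other, so in general only some block sets come from strings.
-- Knowing the block that separates two opposite faces is therefore not enough to build a cube word:
-- it must be possible to write this block into every vertex of the face that lacks it. That forces
-- the face to be constantly `0`, or `00`, at the place of the block, and exactly there a fixed zero
-- can be turned into a free symbol. For this reason the direction of a flip is carried along with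
-- the block, and the induction on the dimension descends into whichever face lacks it. Cubes are
-- counted as vertex sets, so the correspondence with words also needs that distinct words have
-- distinct vertex sets.

length-cartesianProductWith : ∀ {A B C : Set} (f : A → B → C) xs ys →
                              length (cartesianProductWith f xs ys) ≡ length xs · length ys
length-cartesianProductWith f []       ys = refl
length-cartesianProductWith f (x ∷ xs) ys = trans
  (length-++ (map (f x) ys))
  (cong₂ _+_ (length-map (f x) ys) (length-cartesianProductWith f xs ys))

-- Duplicate-free lists with the same elements are permutations of each other. This is used to trade
-- subsets of vertex indices for cube words.
length-filter-image : ∀ {A B : Set} {P : A → Set} (P? : U.Decidable P) {xs : List A} {ys : List B} (g : B → A) →
                      Unique xs → (∀ x → x ∈ₗ xs) → Unique ys → (∀ y → y ∈ₗ ys) →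
                      (∀ {y z} → g y ≡ g z → y ≡ z) → (∀ y → P (g y)) → (∀ x → P x → ∃ λ y → g y ≡ x) →
                      length (filter P? xs) ≡ length ys
length-filter-image P? {xs} {ys} g xs! ∈xs ys! ∈ys g-inj P-g onto = trans
  (↭-length (∼bag⇒↭ (unique∧set⇒bag (Unique.filter⁺ P? xs!) (Unique.map⁺ g-inj ys!) (mk⇔ to from))))
  (length-map g ys)
  where
  to : ∀ {x} → x ∈ₗ filter P? xs → x ∈ₗ map g ys
  to x∈ with onto _ (proj₂ (∈-filter⁻ P? {xs = xs} x∈))
  ... | y , refl = ∈-map⁺ g (∈ys y)

  from : ∀ {x} → x ∈ₗ map g ys → x ∈ₗ filter P? xs
  from x∈ with ∈-map⁻ g x∈
  ... | y , _ , refl = ∈-filter⁺ P? (∈xs (g y)) (P-g y)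

∉-map : ∀ {A B : Set} {f : A → B} {x} xs → (∀ {y} → x ≢ f y) → ¬ x ∈ₗ map f xs
∉-map {f = f} xs x≢ x∈ with _ , _ , eq ← ∈-map⁻ f x∈ = x≢ eq

∉-++ : ∀ {A : Set} {x : A} xs {ys} → ¬ x ∈ₗ xs → ¬ x ∈ₗ ys → ¬ x ∈ₗ xs ++ ys
∉-++ xs ∉xs ∉ys x∈ = Sum.[ ∉xs , ∉ys ] (∈-++⁻ xs x∈)

-- Hypercubes

infix 4 _∼_

-- Hypercube adjacency with the differing coordinate as a position in the derivation, which suits
-- recursion on the bit vector.
data _∼_ : ∀ {p} → Vec Bool p → Vec Bool p → Set where
  here  : ∀ {p} {x : Vec Bool p} {a b} → a ≢ b → a ∷ x ∼ b ∷ x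
  there : ∀ {p} {x y : Vec Bool p} {a} → x ∼ y → a ∷ x ∼ a ∷ y

∼-sym : ∀ {p} {x y : Vec Bool p} → x ∼ y → y ∼ x
∼-sym (here a≢b) = here (a≢b ∘ sym)
∼-sym (there e)  = there (∼-sym e)

lookup-ext : ∀ {A : Set} {p} {x y : Vec A p} → (∀ i → lookup x i ≡ lookup y i) → x ≡ y
lookup-ext {x = x} {y} eq = trans (sym (tabulate∘lookup x)) (trans (tabulate-cong eq) (tabulate∘lookup y))

∼⇒Adj : ∀ {p} {x y : Vec Bool p} → x ∼ y → Graph.Adj (hypercube p) x y
∼⇒Adj (here a≢b) = zero , a≢b , λ { zero j≢i → contradiction refl j≢i ; (suc j) _ → refl }
∼⇒Adj (there e) with ∼⇒Adj e
... | i , ≢i , ≡j = suc i , ≢i , λ { zero _ → refl ; (suc j) j≢i → ≡j j (j≢i ∘ cong suc) }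

Adj⇒∼ : ∀ {p} {x y : Vec Bool p} → Graph.Adj (hypercube p) x y → x ∼ y
Adj⇒∼ {x = a ∷ x} {b ∷ y} (zero , ≢i , ≡j)
  with refl ← lookup-ext {x = x} {y} (λ j → ≡j (suc j) λ ()) = here ≢i
Adj⇒∼ {x = a ∷ x} {b ∷ y} (suc i , ≢i , ≡j) with refl ← ≡j zero (λ ()) =
  there (Adj⇒∼ (i , ≢i , λ j j≢i → ≡j (suc j) (j≢i ∘ Fin.suc-injective)))

-- The coordinates of `x` are corrected one at a time, the last one first.
connected : ∀ {p} (P : Vec Bool p → Set) → (∀ {x y} → x ∼ y → P x → P y) → ∀ x y → P x → P y
connected P step []      []      Px = Px
connected P step (a ∷ x) (b ∷ y) Px with connected (P ∘ (a ∷_)) (step ∘ there) x y Px | a Bool.≟ b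
... | Pay | yes refl = Pay
... | Pay | no a≢b   = step (here a≢b) Pay

module _ {m : ℕ} where

  -- Block strings

  -- The letters are `0,...,k-1` with `k = suc m`, and `kk∷_` counts for two positions. Every
  -- inhabitant is a Pell string, already split into its symbols.
  data Str : ℕ → Set where
    []   : Str 0
    _∷_  : ∀ {n} → Fin (suc m) → Str n → Str (suc n)
    kk∷_ : ∀ {n} → Str n → Str (suc (suc n))

  infixr 5 kk∷_

  -- A block is named by its absolute position, where `single i` means the letter `suc i`. The name
  -- does not depend on the surrounding string, so blocks of different strings can be compared.
  data Block : ℕ → Set where
    single : ∀ {n} → Fin m → Block (suc n)
    double : ∀ {n} → Block (suc (suc n))
    next   : ∀ {n} → Block n → Block (suc n)

  next-injective : ∀ {n} {b c : Block n} → next b ≡ next c → b ≡ c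
  next-injective refl = refl

  infix 4 _≟ᵇ_

  _≟ᵇ_ : ∀ {n} → DecidableEquality (Block n)
  single i ≟ᵇ single j = map′ (cong single) (λ { refl → refl }) (i Fin.≟ j)
  single i ≟ᵇ double   = no λ ()
  single i ≟ᵇ next c   = no λ ()
  double   ≟ᵇ single j = no λ ()
  double   ≟ᵇ double   = yes refl
  double   ≟ᵇ next c   = no λ ()
  next b   ≟ᵇ single j = no λ ()
  next b   ≟ᵇ double   = no λ ()
  next b   ≟ᵇ next c   = map′ (cong next) next-injective (b ≟ᵇ c)

  -- Indicator function of the set of nonzero blocks. A `kk` covers two positions, and no block
  -- starts at the second.
  χ : ∀ {n} → Str n → Block n → Bool
  χ (a ∷ s)     (single i)        = does (a Fin.≟ suc i)
  χ (a ∷ s)     double            = false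
  χ (a ∷ s)     (next b)          = χ s b
  χ (kk∷ s)     (single i)        = false
  χ (kk∷ s)     double            = true
  χ (kk∷ s)     (next (single i)) = false
  χ (kk∷ s)     (next double)     = false
  χ (kk∷ s)     (next (next b))   = χ s b

  χ-injective : ∀ {n} (s r : Str n) → (∀ b → χ s b ≡ χ r b) → s ≡ r
  χ-injective []          []          eq = refl
  χ-injective (zero ∷ s)  (zero ∷ r)  eq = cong (zero ∷_) (χ-injective s r (eq ∘ next))
  χ-injective (zero ∷ s)  (suc j ∷ r) eq = contradiction (trans (eq (single j)) (dec-true (j Fin.≟ j) refl)) λ ()
  χ-injective (suc i ∷ s) (zero ∷ r)  eq = contradiction (trans (sym (eq (single i))) (dec-true (i Fin.≟ i) refl)) λ ()
  χ-injective (suc i ∷ s) (suc j ∷ r) eq with i Fin.≟ j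
  ... | yes refl = cong (suc i ∷_) (χ-injective s r (eq ∘ next))
  ... | no i≢j   = contradiction
    (trans (sym (dec-false (i Fin.≟ j) i≢j)) (trans (eq (single j)) (dec-true (j Fin.≟ j) refl))) λ ()
  χ-injective (a ∷ s)     (kk∷ r)     eq = contradiction (eq double) λ ()
  χ-injective (kk∷ s)     (a ∷ r)     eq = contradiction (eq double) λ ()
  χ-injective (kk∷ s)     (kk∷ r)     eq = cong kk∷_ (χ-injective s r (eq ∘ next ∘ next))

  -- Passing a `kk` costs two `next`, in keeping with absolute positions.
  data Add : ∀ {n} → Block n → Str n → Str n → Set where
    single  : ∀ {n} {s : Str n} {i} → Add (single i) (zero ∷ s) (suc i ∷ s)
    double  : ∀ {n} {s : Str n} → Add double (zero ∷ zero ∷ s) (kk∷ s)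
    next    : ∀ {n} {b : Block n} {s r a} → Add b s r → Add (next b) (a ∷ s) (a ∷ r)
    next-kk : ∀ {n} {b : Block n} {s r} → Add b s r → Add (next (next b)) (kk∷ s) (kk∷ r)

  Add-χ-source : ∀ {n} {b : Block n} {s r} → Add b s r → χ s b ≡ false
  Add-χ-source single      = refl
  Add-χ-source double      = refl
  Add-χ-source (next e)    = Add-χ-source e
  Add-χ-source (next-kk e) = Add-χ-source e

  Add-χ-target : ∀ {n} {b : Block n} {s r} → Add b s r → χ r b ≡ true
  Add-χ-target (single {i = i}) = dec-true (i Fin.≟ i) refl
  Add-χ-target double           = refl
  Add-χ-target (next e)         = Add-χ-target e
  Add-χ-target (next-kk e)      = Add-χ-target e

  Add-χ-other : ∀ {n} {b : Block n} {s r} → Add b s r → ∀ c → c ≢ b → χ s c ≡ χ r c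
  Add-χ-other (single {i = i})   (single j)        c≢b = sym (dec-false (i Fin.≟ j) (λ i≡j → c≢b (cong single (sym i≡j))))
  Add-χ-other single             double            c≢b = refl
  Add-χ-other single             (next c)          c≢b = refl
  Add-χ-other double             (single j)        c≢b = refl
  Add-χ-other double             double            c≢b = contradiction refl c≢b
  Add-χ-other double             (next (single j)) c≢b = refl
  Add-χ-other double             (next double)     c≢b = refl
  Add-χ-other double             (next (next c))   c≢b = refl
  Add-χ-other (next e)           (single j)        c≢b = refl
  Add-χ-other (next e)           double            c≢b = refl
  Add-χ-other (next e)           (next c)          c≢b = Add-χ-other e c (c≢b ∘ cong next)
  Add-χ-other (next-kk e)        (single j)        c≢b = refl
  Add-χ-other (next-kk e)        double            c≢b = refl
  Add-χ-other (next-kk e)        (next (single j)) c≢b = refl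
  Add-χ-other (next-kk e)        (next double)     c≢b = refl
  Add-χ-other (next-kk e)        (next (next c))   c≢b = Add-χ-other e c (λ c≡b → c≢b (cong (λ d → next (next d)) c≡b))

  Flip : ∀ {n} → Block n → Str n → Str n → Set
  Flip b s r = Add b s r ⊎ Add b r s

  Flip-χ-at : ∀ {n} {b : Block n} {s r} → Flip b s r → χ r b ≡ not (χ s b)
  Flip-χ-at (inj₁ e) = trans (Add-χ-target e) (cong not (sym (Add-χ-source e)))
  Flip-χ-at (inj₂ e) = trans (Add-χ-source e) (cong not (sym (Add-χ-target e)))

  Flip-χ-other : ∀ {n} {b : Block n} {s r} → Flip b s r → ∀ c → c ≢ b → χ s c ≡ χ r c
  Flip-χ-other (inj₁ e) c c≢b = Add-χ-other e c c≢b
  Flip-χ-other (inj₂ e) c c≢b = sym (Add-χ-other e c c≢b)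

  Flip-functional : ∀ {n} {b : Block n} {s r r′} → Flip b s r → Flip b s r′ → r ≡ r′
  Flip-functional {b = b} {s} {r} {r′} e e′ = χ-injective r r′ agree
    where
    agree : ∀ c → χ r c ≡ χ r′ c
    agree c with c ≟ᵇ b
    ... | yes refl = trans (Flip-χ-at e) (sym (Flip-χ-at e′))
    ... | no c≢b   = trans (sym (Flip-χ-other e c c≢b)) (Flip-χ-other e′ c c≢b)

  Flip-sym : ∀ {n} {b : Block n} {s r} → Flip b s r → Flip b r s
  Flip-sym = Sum.swap

  -- The distinct diagonals exclude `b₁ ≡ b₂` and `b₁ ≡ b₃`. Were also `b₁ ≢ b₄`, walking along the
  -- other three sides would preserve the entry at `b₁`, which the side `b₁` changes. The second
  -- component says that `b₁` is flipped in the same direction on both opposite sides.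
  square : ∀ {n} {b₁ b₂ b₃ b₄ : Block n} {s r s′ r′} →
           Flip b₁ s r → Flip b₂ s s′ → Flip b₃ r r′ → Flip b₄ s′ r′ →
           r ≢ s′ → s ≢ r′ → b₁ ≡ b₄ × χ s b₁ ≡ χ s′ b₁
  square {b₁ = b₁} {b₂} {b₃} {b₄} {s} {r} {s′} {r′} e₁ e₂ e₃ e₄ r≢s′ s≢r′ = b₁≡b₄ , χs≡χs′
    where
    b₁≢b₂ : b₁ ≢ b₂
    b₁≢b₂ refl = r≢s′ (Flip-functional e₁ e₂)

    b₁≢b₃ : b₁ ≢ b₃
    b₁≢b₃ refl = s≢r′ (Flip-functional (Flip-sym e₁) e₃)

    χs≡χs′ : χ s b₁ ≡ χ s′ b₁
    χs≡χs′ = Flip-χ-other e₂ b₁ b₁≢b₂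

    b₁≡b₄ : b₁ ≡ b₄
    b₁≡b₄ with b₁ ≟ᵇ b₄
    ... | yes eq = eq
    ... | no b₁≢b₄ = contradiction
      (trans χs≡χs′ (trans (Flip-χ-other e₄ b₁ b₁≢b₄) (trans (sym (Flip-χ-other e₃ b₁ b₁≢b₃)) (Flip-χ-at e₁))))
      (Bool.not-¬ refl)

  Adjacent : ∀ {n} → Str n → Str n → Set
  Adjacent s r = ∃ λ b → Flip b s r

  -- Cubes as words

  data Cube : ℕ → ℕ → Set where
    []      : Cube 0 0
    fix     : ∀ {n p} → Fin (suc m) → Cube n p → Cube (suc n) p
    kk      : ∀ {n p} → Cube n p → Cube (suc (suc n)) p
    edge    : ∀ {n p} → Fin m → Cube n p → Cube (suc n) (suc p)
    kk-edge : ∀ {n p} → Cube n p → Cube (suc (suc n)) (suc p)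

  vertex : ∀ {n p} → Cube n p → Vec Bool p → Str n
  vertex []          x           = []
  vertex (fix a c)   x           = a ∷ vertex c x
  vertex (kk c)      x           = kk∷ vertex c x
  vertex (edge i c)  (false ∷ x) = zero ∷ vertex c x
  vertex (edge i c)  (true ∷ x)  = suc i ∷ vertex c x
  vertex (kk-edge c) (false ∷ x) = zero ∷ zero ∷ vertex c x
  vertex (kk-edge c) (true ∷ x)  = kk∷ vertex c x

  infix 4 _∈_

  -- An inductive relation rather than the image of `vertex`: matching on a derivation exposes the
  -- first symbol of the cube, and the absurd cases of `∈-ext` and `extend` rest on this.
  data _∈_ : ∀ {n p} → Str n → Cube n p → Set where
    []       : [] ∈ []
    fix∈     : ∀ {n p s} {c : Cube n p} {a} → s ∈ c → a ∷ s ∈ fix a c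
    kk∈      : ∀ {n p s} {c : Cube n p} → s ∈ c → kk∷ s ∈ kk c
    edge₀    : ∀ {n p s} {c : Cube n p} {i} → s ∈ c → zero ∷ s ∈ edge i c
    edge₁    : ∀ {n p s} {c : Cube n p} {i} → s ∈ c → suc i ∷ s ∈ edge i c
    kk-edge₀ : ∀ {n p s} {c : Cube n p} → s ∈ c → zero ∷ zero ∷ s ∈ kk-edge c
    kk-edge₁ : ∀ {n p s} {c : Cube n p} → s ∈ c → kk∷ s ∈ kk-edge c

  vertex∈ : ∀ {n p} (c : Cube n p) x → vertex c x ∈ c
  vertex∈ []          []          = []
  vertex∈ (fix a c)   x           = fix∈ (vertex∈ c x)
  vertex∈ (kk c)      x           = kk∈ (vertex∈ c x)
  vertex∈ (edge i c)  (false ∷ x) = edge₀ (vertex∈ c x)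
  vertex∈ (edge i c)  (true ∷ x)  = edge₁ (vertex∈ c x)
  vertex∈ (kk-edge c) (false ∷ x) = kk-edge₀ (vertex∈ c x)
  vertex∈ (kk-edge c) (true ∷ x)  = kk-edge₁ (vertex∈ c x)

  ∈⇒vertex : ∀ {n p s} {c : Cube n p} → s ∈ c → ∃ λ x → vertex c x ≡ s
  ∈⇒vertex []           = [] , refl
  ∈⇒vertex (fix∈ s∈)      with x , refl ← ∈⇒vertex s∈ = x , refl
  ∈⇒vertex (kk∈ s∈)       with x , refl ← ∈⇒vertex s∈ = x , refl
  ∈⇒vertex (edge₀ s∈)    with x , refl ← ∈⇒vertex s∈ = false ∷ x , refl
  ∈⇒vertex (edge₁ s∈)    with x , refl ← ∈⇒vertex s∈ = true ∷ x , refl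
  ∈⇒vertex (kk-edge₀ s∈) with x , refl ← ∈⇒vertex s∈ = false ∷ x , refl
  ∈⇒vertex (kk-edge₁ s∈) with x , refl ← ∈⇒vertex s∈ = true ∷ x , refl

  inhabited : ∀ {n p} (c : Cube n p) → ∃ (_∈ c)
  inhabited c = _ , vertex∈ c (replicate _ false)

  ∷-injectiveʳˢ : ∀ {n} {a b} {s r : Str n} → _≡_ {A = Str (suc n)} (a ∷ s) (b ∷ r) → s ≡ r
  ∷-injectiveʳˢ refl = refl

  kk∷-injective : ∀ {n} {s r : Str n} → kk∷ s ≡ kk∷ r → s ≡ r
  kk∷-injective refl = refl

  vertex-injective : ∀ {n p} (c : Cube n p) {x y} → vertex c x ≡ vertex c y → x ≡ y
  vertex-injective []          {[]}        {[]}        eq = refl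
  vertex-injective (fix a c)   eq = vertex-injective c (∷-injectiveʳˢ eq)
  vertex-injective (kk c)      eq = vertex-injective c (kk∷-injective eq)
  vertex-injective (edge i c)  {false ∷ x} {false ∷ y} eq = cong (false ∷_) (vertex-injective c (∷-injectiveʳˢ eq))
  vertex-injective (edge i c)  {false ∷ x} {true ∷ y}  ()
  vertex-injective (edge i c)  {true ∷ x}  {false ∷ y} ()
  vertex-injective (edge i c)  {true ∷ x}  {true ∷ y}  eq = cong (true ∷_) (vertex-injective c (∷-injectiveʳˢ eq))
  vertex-injective (kk-edge c) {false ∷ x} {false ∷ y} eq = cong (false ∷_) (vertex-injective c (∷-injectiveʳˢ (∷-injectiveʳˢ eq)))
  vertex-injective (kk-edge c) {false ∷ x} {true ∷ y}  ()
  vertex-injective (kk-edge c) {true ∷ x}  {false ∷ y} ()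
  vertex-injective (kk-edge c) {true ∷ x}  {true ∷ y}  eq = cong (true ∷_) (vertex-injective c (kk∷-injective eq))

  Adjacent-∷ : ∀ {n a} {s r : Str n} → Adjacent s r → Adjacent (a ∷ s) (a ∷ r)
  Adjacent-∷ (b , e) = next b , Sum.map next next e

  Adjacent-kk∷ : ∀ {n} {s r : Str n} → Adjacent s r → Adjacent (kk∷ s) (kk∷ r)
  Adjacent-kk∷ (b , e) = next (next b) , Sum.map next-kk next-kk e

  vertex-Adjacent⁺ : ∀ {n p} (c : Cube n p) {x y} → x ∼ y → Adjacent (vertex c x) (vertex c y)
  vertex-Adjacent⁺ (fix a c)   e = Adjacent-∷ (vertex-Adjacent⁺ c e)
  vertex-Adjacent⁺ (kk c)      e = Adjacent-kk∷ (vertex-Adjacent⁺ c e)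
  vertex-Adjacent⁺ (edge i c)  (here {a = false} {false} a≢b) = contradiction refl a≢b
  vertex-Adjacent⁺ (edge i c)  (here {a = false} {true}  a≢b) = single i , inj₁ single
  vertex-Adjacent⁺ (edge i c)  (here {a = true}  {false} a≢b) = single i , inj₂ single
  vertex-Adjacent⁺ (edge i c)  (here {a = true}  {true}  a≢b) = contradiction refl a≢b
  vertex-Adjacent⁺ (edge i c)  (there {a = false} e)          = Adjacent-∷ (vertex-Adjacent⁺ c e)
  vertex-Adjacent⁺ (edge i c)  (there {a = true}  e)          = Adjacent-∷ (vertex-Adjacent⁺ c e)
  vertex-Adjacent⁺ (kk-edge c) (here {a = false} {false} a≢b) = contradiction refl a≢b
  vertex-Adjacent⁺ (kk-edge c) (here {a = false} {true}  a≢b) = double , inj₁ double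
  vertex-Adjacent⁺ (kk-edge c) (here {a = true}  {false} a≢b) = double , inj₂ double
  vertex-Adjacent⁺ (kk-edge c) (here {a = true}  {true}  a≢b) = contradiction refl a≢b
  vertex-Adjacent⁺ (kk-edge c) (there {a = false} e)          = Adjacent-∷ (Adjacent-∷ (vertex-Adjacent⁺ c e))
  vertex-Adjacent⁺ (kk-edge c) (there {a = true}  e)          = Adjacent-kk∷ (vertex-Adjacent⁺ c e)

  Add-∷⁻ : ∀ {n a} {b : Block (suc n)} {s r : Str n} → Add b (a ∷ s) (a ∷ r) → ∃ λ b′ → Add b′ s r
  Add-∷⁻ (next e) = _ , e

  Add-kk∷⁻ : ∀ {n} {b : Block (suc (suc n))} {s r : Str n} → Add b (kk∷ s) (kk∷ r) → ∃ λ b′ → Add b′ s r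
  Add-kk∷⁻ (next-kk e) = _ , e

  Add-0∷suc∷ : ∀ {n i} {b : Block (suc n)} {s r : Str n} → Add b (zero ∷ s) (suc i ∷ r) → s ≡ r
  Add-0∷suc∷ single = refl

  Add-0∷0∷kk∷ : ∀ {n} {b : Block (suc (suc n))} {s r : Str n} → Add b (zero ∷ zero ∷ s) (kk∷ r) → s ≡ r
  Add-0∷0∷kk∷ double = refl

  -- The vertices of a cube word have no edges beyond those of the hypercube: if a free symbol
  -- differs between two adjacent vertices, then the added block is that symbol, and the tails
  -- coincide.
  vertex-Add⁻ : ∀ {n p} (c : Cube n p) {x y b} → Add b (vertex c x) (vertex c y) → x ∼ y
  vertex-Add⁻ (fix a c)   e = vertex-Add⁻ c (proj₂ (Add-∷⁻ e))
  vertex-Add⁻ (kk c)      e = vertex-Add⁻ c (proj₂ (Add-kk∷⁻ e))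
  vertex-Add⁻ (edge i c)  {false ∷ x} {false ∷ y} e = there (vertex-Add⁻ c (proj₂ (Add-∷⁻ e)))
  vertex-Add⁻ (edge i c)  {false ∷ x} {true ∷ y}  e with refl ← vertex-injective c (Add-0∷suc∷ e) = here λ ()
  vertex-Add⁻ (edge i c)  {true ∷ x}  {false ∷ y} ()
  vertex-Add⁻ (edge i c)  {true ∷ x}  {true ∷ y}  e = there (vertex-Add⁻ c (proj₂ (Add-∷⁻ e)))
  vertex-Add⁻ (kk-edge c) {false ∷ x} {false ∷ y} e = there (vertex-Add⁻ c (proj₂ (Add-∷⁻ (proj₂ (Add-∷⁻ e)))))
  vertex-Add⁻ (kk-edge c) {false ∷ x} {true ∷ y}  e with refl ← vertex-injective c (Add-0∷0∷kk∷ e) = here λ ()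
  vertex-Add⁻ (kk-edge c) {true ∷ x}  {false ∷ y} ()
  vertex-Add⁻ (kk-edge c) {true ∷ x}  {true ∷ y}  e = there (vertex-Add⁻ c (proj₂ (Add-kk∷⁻ e)))

  vertex-Adjacent⁻ : ∀ {n p} (c : Cube n p) {x y} → Adjacent (vertex c x) (vertex c y) → x ∼ y
  vertex-Adjacent⁻ c (b , inj₁ e) = vertex-Add⁻ c e
  vertex-Adjacent⁻ c (b , inj₂ e) = ∼-sym (vertex-Add⁻ c e)

  -- The first symbol can be recovered from the vertices. One vertex separates most pairs of
  -- symbols; `fix` and `edge` are told apart by two vertices, one beginning with `zero` and one
  -- with `suc`.
  ∈-ext : ∀ {n p} (c d : Cube n p) → (∀ {s} → s ∈ c → s ∈ d) → (∀ {s} → s ∈ d → s ∈ c) → c ≡ d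
  ∈-ext []          []          c⊆d d⊆c = refl
  ∈-ext (fix a c)   (fix b d)   c⊆d d⊆c with c⊆d (fix∈ (proj₂ (inhabited c)))
  ... | fix∈ _ = cong (fix a) (∈-ext c d (λ s∈ → case-fix (c⊆d (fix∈ s∈))) (λ s∈ → case-fix (d⊆c (fix∈ s∈))))
    where
    case-fix : ∀ {n p a s} {c : Cube n p} → a ∷ s ∈ fix a c → s ∈ c
    case-fix (fix∈ s∈) = s∈
  ∈-ext (fix a c)   (kk d)      c⊆d d⊆c = contradiction (c⊆d (fix∈ (proj₂ (inhabited c)))) λ ()
  ∈-ext (fix a c)   (edge j d)  c⊆d d⊆c
    with d⊆c (edge₀ (proj₂ (inhabited d))) | d⊆c (edge₁ (proj₂ (inhabited d)))
  -- The first vertex forces `a` to be `zero`, and the second contradicts this.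
  ... | fix∈ _ | ()
  ∈-ext (fix a c)   (kk-edge d) c⊆d d⊆c = contradiction (d⊆c (kk-edge₁ (proj₂ (inhabited d)))) λ ()
  ∈-ext (kk c)      (fix b d)   c⊆d d⊆c = contradiction (c⊆d (kk∈ (proj₂ (inhabited c)))) λ ()
  ∈-ext (kk c)      (kk d)      c⊆d d⊆c =
    cong kk (∈-ext c d (λ s∈ → case-kk (c⊆d (kk∈ s∈))) (λ s∈ → case-kk (d⊆c (kk∈ s∈))))
    where
    case-kk : ∀ {n p s} {c : Cube n p} → kk∷ s ∈ kk c → s ∈ c
    case-kk (kk∈ s∈) = s∈
  ∈-ext (kk c)      (edge j d)  c⊆d d⊆c = contradiction (c⊆d (kk∈ (proj₂ (inhabited c)))) λ ()
  ∈-ext (kk c)      (kk-edge d) c⊆d d⊆c = contradiction (d⊆c (kk-edge₀ (proj₂ (inhabited d)))) λ ()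
  ∈-ext (edge i c)  (fix b d)   c⊆d d⊆c
    with c⊆d (edge₀ (proj₂ (inhabited c))) | c⊆d (edge₁ (proj₂ (inhabited c)))
  ... | fix∈ _ | ()
  ∈-ext (edge i c)  (kk d)      c⊆d d⊆c = contradiction (c⊆d (edge₀ (proj₂ (inhabited c)))) λ ()
  ∈-ext (edge i c)  (edge j d)  c⊆d d⊆c with c⊆d (edge₁ (proj₂ (inhabited c)))
  ... | edge₁ _ = cong (edge i) (∈-ext c d (λ s∈ → case-edge (c⊆d (edge₀ s∈))) (λ s∈ → case-edge (d⊆c (edge₀ s∈))))
    where
    case-edge : ∀ {n p i s} {c : Cube n p} → zero ∷ s ∈ edge i c → s ∈ c
    case-edge (edge₀ s∈) = s∈
  ∈-ext (edge i c)  (kk-edge d) c⊆d d⊆c = contradiction (d⊆c (kk-edge₁ (proj₂ (inhabited d)))) λ ()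
  ∈-ext (kk-edge c) (fix b d)   c⊆d d⊆c = contradiction (c⊆d (kk-edge₁ (proj₂ (inhabited c)))) λ ()
  ∈-ext (kk-edge c) (kk d)      c⊆d d⊆c = contradiction (c⊆d (kk-edge₀ (proj₂ (inhabited c)))) λ ()
  ∈-ext (kk-edge c) (edge j d)  c⊆d d⊆c = contradiction (c⊆d (kk-edge₁ (proj₂ (inhabited c)))) λ ()
  ∈-ext (kk-edge c) (kk-edge d) c⊆d d⊆c =
    cong kk-edge (∈-ext c d (λ s∈ → case-kk-edge (c⊆d (kk-edge₁ s∈))) (λ s∈ → case-kk-edge (d⊆c (kk-edge₁ s∈))))
    where
    case-kk-edge : ∀ {n p s} {c : Cube n p} → kk∷ s ∈ kk-edge c → s ∈ c
    case-kk-edge (kk-edge₁ s∈) = s∈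

  -- Doubling a cube along a block

  data Extended {n p} (c : Cube n p) (b : Block n) (s : Str n) : Set where
    old : s ∈ c → Extended c b s
    new : ∀ {r} → r ∈ c → Add b r s → Extended c b s

  addable-∷⁻ : ∀ {n a b} {s : Str n} → ∃ (Add (next b) (a ∷ s)) → ∃ (Add b s)
  addable-∷⁻ (_ , next e) = _ , e

  addable-kk∷⁻ : ∀ {n b} {s : Str n} → ∃ (Add (next (next b)) (kk∷ s)) → ∃ (Add b s)
  addable-kk∷⁻ (_ , next-kk e) = _ , e

  -- The symbols of `c` at the place of `b` can only be `fix zero`: an `edge`, `kk` or `kk-edge`
  -- there has a vertex with a nonzero entry, to which `b` cannot be added. Replacing one
  -- `fix zero`, or two of them if the block is a `double`, by the free symbol gives the union of
  -- `c` and its translate by `b`.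
  extend : ∀ {n p} (c : Cube n p) b → (∀ {s} → s ∈ c → ∃ (Add b s)) →
           ∃ λ (c′ : Cube n (suc p)) → ∀ s → s ∈ c′ ⇔ Extended c b s
  extend (fix a c) (single i) add with add (fix∈ (proj₂ (inhabited c)))
  ... | _ , single = edge i c , λ s → mk⇔
    (λ { (edge₀ s∈) → old (fix∈ s∈) ; (edge₁ s∈) → new (fix∈ s∈) single })
    (λ { (old (fix∈ s∈)) → edge₀ s∈ ; (new (fix∈ s∈) single) → edge₁ s∈ })
  extend (fix a (fix a′ c)) double add with add (fix∈ (fix∈ (proj₂ (inhabited c))))
  ... | _ , double = kk-edge c , λ s → mk⇔
    (λ { (kk-edge₀ s∈) → old (fix∈ (fix∈ s∈)) ; (kk-edge₁ s∈) → new (fix∈ (fix∈ s∈)) double })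
    (λ { (old (fix∈ (fix∈ s∈))) → kk-edge₀ s∈ ; (new (fix∈ (fix∈ s∈)) double) → kk-edge₁ s∈ })
  extend (fix a (kk c))      double add = contradiction (add (fix∈ (kk∈ (proj₂ (inhabited c))))) λ ()
  extend (fix a (edge i c))  double add = contradiction (add (fix∈ (edge₁ (proj₂ (inhabited c))))) λ ()
  extend (fix a (kk-edge c)) double add = contradiction (add (fix∈ (kk-edge₁ (proj₂ (inhabited c))))) λ ()
  extend (fix a c) (next b) add
    with c′ , eqv ← extend c b (λ s∈ → addable-∷⁻ (add (fix∈ s∈)))
    = fix a c′ , λ s → mk⇔
      (λ { (fix∈ s∈) → up (Equivalence.to (eqv _) s∈) })
      (λ { (old (fix∈ s∈)) → fix∈ (Equivalence.from (eqv _) (old s∈))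
         ; (new (fix∈ s∈) (next e)) → fix∈ (Equivalence.from (eqv _) (new s∈ e)) })
    where
    up : ∀ {s} → Extended c b s → Extended (fix a c) (next b) (a ∷ s)
    up (old s∈)   = old (fix∈ s∈)
    up (new r∈ e) = new (fix∈ r∈) (next e)
  extend (kk c) (single i)        add = contradiction (add (kk∈ (proj₂ (inhabited c)))) λ ()
  extend (kk c) double            add = contradiction (add (kk∈ (proj₂ (inhabited c)))) λ ()
  extend (kk c) (next (single i)) add = contradiction (add (kk∈ (proj₂ (inhabited c)))) λ ()
  extend (kk c) (next double)     add = contradiction (add (kk∈ (proj₂ (inhabited c)))) λ ()
  extend (kk c) (next (next b))   add
    with c′ , eqv ← extend c b (λ s∈ → addable-kk∷⁻ (add (kk∈ s∈)))
    = kk c′ , λ s → mk⇔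
      (λ { (kk∈ s∈) → up (Equivalence.to (eqv _) s∈) })
      (λ { (old (kk∈ s∈)) → kk∈ (Equivalence.from (eqv _) (old s∈))
         ; (new (kk∈ s∈) (next-kk e)) → kk∈ (Equivalence.from (eqv _) (new s∈ e)) })
    where
    up : ∀ {s} → Extended c b s → Extended (kk c) (next (next b)) (kk∷ s)
    up (old s∈)   = old (kk∈ s∈)
    up (new r∈ e) = new (kk∈ r∈) (next-kk e)
  extend (edge i c) (single j) add = contradiction (add (edge₁ (proj₂ (inhabited c)))) λ ()
  extend (edge i c) double     add = contradiction (add (edge₁ (proj₂ (inhabited c)))) λ ()
  extend (edge i c) (next b)   add
    with c′ , eqv ← extend c b (λ s∈ → addable-∷⁻ (add (edge₁ s∈)))
    = edge i c′ , λ s → mk⇔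
      (λ { (edge₀ s∈) → up₀ (Equivalence.to (eqv _) s∈) ; (edge₁ s∈) → up₁ (Equivalence.to (eqv _) s∈) })
      (λ { (old (edge₀ s∈)) → edge₀ (Equivalence.from (eqv _) (old s∈))
         ; (old (edge₁ s∈)) → edge₁ (Equivalence.from (eqv _) (old s∈))
         ; (new (edge₀ s∈) (next e)) → edge₀ (Equivalence.from (eqv _) (new s∈ e))
         ; (new (edge₁ s∈) (next e)) → edge₁ (Equivalence.from (eqv _) (new s∈ e)) })
    where
    up₀ : ∀ {s} → Extended c b s → Extended (edge i c) (next b) (zero ∷ s)
    up₀ (old s∈)   = old (edge₀ s∈)
    up₀ (new r∈ e) = new (edge₀ r∈) (next e)

    up₁ : ∀ {s} → Extended c b s → Extended (edge i c) (next b) (suc i ∷ s)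
    up₁ (old s∈)   = old (edge₁ s∈)
    up₁ (new r∈ e) = new (edge₁ r∈) (next e)
  extend (kk-edge c) (single j)        add = contradiction (add (kk-edge₁ (proj₂ (inhabited c)))) λ ()
  extend (kk-edge c) double            add = contradiction (add (kk-edge₁ (proj₂ (inhabited c)))) λ ()
  extend (kk-edge c) (next (single i)) add = contradiction (add (kk-edge₁ (proj₂ (inhabited c)))) λ ()
  extend (kk-edge c) (next double)     add = contradiction (add (kk-edge₁ (proj₂ (inhabited c)))) λ ()
  extend (kk-edge c) (next (next b))   add
    with c′ , eqv ← extend c b (λ s∈ → addable-kk∷⁻ (add (kk-edge₁ s∈)))
    = kk-edge c′ , λ s → mk⇔
      (λ { (kk-edge₀ s∈) → up₀ (Equivalence.to (eqv _) s∈) ; (kk-edge₁ s∈) → up₁ (Equivalence.to (eqv _) s∈) })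
      (λ { (old (kk-edge₀ s∈)) → kk-edge₀ (Equivalence.from (eqv _) (old s∈))
         ; (old (kk-edge₁ s∈)) → kk-edge₁ (Equivalence.from (eqv _) (old s∈))
         ; (new (kk-edge₀ s∈) (next (next e))) → kk-edge₀ (Equivalence.from (eqv _) (new s∈ e))
         ; (new (kk-edge₁ s∈) (next-kk e)) → kk-edge₁ (Equivalence.from (eqv _) (new s∈ e)) })
    where
    up₀ : ∀ {s} → Extended c b s → Extended (kk-edge c) (next (next b)) (zero ∷ zero ∷ s)
    up₀ (old s∈)   = old (kk-edge₀ s∈)
    up₀ (new r∈ e) = new (kk-edge₀ r∈) (next (next e))

    up₁ : ∀ {s} → Extended c b s → Extended (kk-edge c) (next (next b)) (kk∷ s)
    up₁ (old s∈)   = old (kk-edge₁ s∈)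
    up₁ (new r∈ e) = new (kk-edge₁ r∈) (next-kk e)

  -- From embedded hypercubes to cube words

  point : ∀ {n} → Str n → Cube n 0
  point []      = []
  point (a ∷ s) = fix a (point s)
  point (kk∷ s) = kk (point s)

  ∈-point⁺ : ∀ {n} (s : Str n) → s ∈ point s
  ∈-point⁺ []      = []
  ∈-point⁺ (a ∷ s) = fix∈ (∈-point⁺ s)
  ∈-point⁺ (kk∷ s) = kk∈ (∈-point⁺ s)

  ∈-point⁻ : ∀ {n} (s : Str n) {r} → r ∈ point s → s ≡ r
  ∈-point⁻ []      []       = refl
  ∈-point⁻ (a ∷ s) (fix∈ r∈) = cong (a ∷_) (∈-point⁻ s r∈)
  ∈-point⁻ (kk∷ s) (kk∈ r∈)  = cong kk∷_ (∈-point⁻ s r∈)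

  Spans : ∀ {n p} → Cube n p → (Vec Bool p → Str n) → Set
  Spans c f = ∀ s → s ∈ c ⇔ (∃ λ x → f x ≡ s)

  -- Injectivity keeps the diagonals of each 4-cycle distinct, as `square` requires.
  record IsEmbedding {n p} (f : Vec Bool p → Str n) : Set where
    field
      injective : ∀ {x y} → f x ≡ f y → x ≡ y
      adjacent  : ∀ {x y} → x ∼ y → Adjacent (f x) (f y)

  face : ∀ {n p} {f : Vec Bool (suc p) → Str n} a → IsEmbedding f → IsEmbedding (f ∘ (a ∷_))
  face a emb = record
    { injective = λ eq → ∷-injectiveʳ (injective eq)
    ; adjacent  = λ e → adjacent (there e)
    }
    where open IsEmbedding emb

  -- By `square`, moving along an edge of the face keeps both the block and the direction of its
  -- flip. As a face is connected, one edge between the two faces decides all of them.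
  parallel : ∀ {n p} {f : Vec Bool (suc p) → Str n} → IsEmbedding f → ∀ {a a′} → a ≢ a′ → ∀ {x b} →
             Add b (f (a ∷ x)) (f (a′ ∷ x)) → ∀ y → Add b (f (a ∷ y)) (f (a′ ∷ y))
  parallel {f = f} emb {a} {a′} a≢a′ {x} {b} e y =
    connected (λ y → Add b (f (a ∷ y)) (f (a′ ∷ y))) step x y e
    where
    open IsEmbedding emb

    step : ∀ {x y} → x ∼ y → Add b (f (a ∷ x)) (f (a′ ∷ x)) → Add b (f (a ∷ y)) (f (a′ ∷ y))
    step {x} {y} x∼y e with adjacent (here {x = y} a≢a′)
    ... | b₄ , e₄ with square (inj₁ e) (proj₂ (adjacent (there {a = a} x∼y))) (proj₂ (adjacent (there {a = a′} x∼y))) e₄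
                         (λ eq → a≢a′ (sym (∷-injectiveˡ (injective eq)))) (λ eq → a≢a′ (∷-injectiveˡ (injective eq)))
    ... | refl , same with e₄
    ... | inj₁ e′ = e′
    -- Removing `b` would require it in `f (a ∷ y)`, but its entry there agrees with the one in
    -- `f (a ∷ x)`, where `b` is still to be added.
    ... | inj₂ e′ = contradiction (trans (sym (Add-χ-source e)) (trans same (Add-χ-target e′))) λ ()

  -- Here `a` is the face without `b`. The opposite face is its translate by `b`, and this translate
  -- is what `extend` adjoins.
  glue : ∀ {n p} {f : Vec Bool (suc p) → Str n} {a a′ b} → a ≢ a′ → (c : Cube n p) → Spans c (f ∘ (a ∷_)) →
         (∀ y → Add b (f (a ∷ y)) (f (a′ ∷ y))) → ∃ λ c′ → Spans c′ f
  glue {n} {p} {f} {a} {a′} {b} a≢a′ c spans add =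
    proj₁ ext , λ s → mk⇔ (to s ∘ Equivalence.to (proj₂ ext s)) (Equivalence.from (proj₂ ext s) ∘ from s)
    where
    extends : ∀ {s} → s ∈ c → ∃ (Add b s)
    extends s∈ with x , refl ← Equivalence.to (spans _) s∈ = _ , add x

    ext : ∃ λ c′ → ∀ s → s ∈ c′ ⇔ Extended c b s
    ext = extend c b extends

    to : ∀ s → Extended c b s → ∃ λ x → f x ≡ s
    to s (old s∈)   with x , refl ← Equivalence.to (spans _) s∈ = a ∷ x , refl
    to s (new r∈ e) with x , refl ← Equivalence.to (spans _) r∈ = a′ ∷ x , Flip-functional (inj₁ (add x)) (inj₁ e)

    from : ∀ s → (∃ λ x → f x ≡ s) → Extended c b s
    from s (a″ ∷ x , refl) with a″ Bool.≟ a
    ... | yes refl = old (Equivalence.from (spans _) (x , refl))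
    -- Among two Booleans, `a″ ≢ a` leaves only `a′`.
    ... | no a″≢a with refl ← trans (Bool.¬-not a″≢a) (sym (Bool.¬-not (a≢a′ ∘ sym))) =
      new (Equivalence.from (spans _) (x , refl)) (add x)

  embedding⇒cube : ∀ {n} p (f : Vec Bool p → Str n) → IsEmbedding f → ∃ λ c → Spans c f
  embedding⇒cube zero f emb = point (f []) , λ s → mk⇔
    (λ s∈ → [] , ∈-point⁻ (f []) s∈)
    (λ { ([] , refl) → ∈-point⁺ (f []) })
  -- The choice `replicate p false` is arbitrary: by `parallel`, any edge between the faces tells
  -- which of them lacks the block, and the recursion enters that one.
  embedding⇒cube (suc p) f emb with IsEmbedding.adjacent emb (here {x = replicate p false} {false} {true} λ ())
  ... | b , inj₁ e with c , spans ← embedding⇒cube p (f ∘ (false ∷_)) (face false emb) =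
    glue (λ ()) c spans (parallel emb (λ ()) e)
  ... | b , inj₂ e with c , spans ← embedding⇒cube p (f ∘ (true ∷_)) (face true emb) =
    glue (λ ()) c spans (parallel emb (λ ()) e)

  -- Pell strings

  word : ∀ {n} → Str n → Word (suc m) n
  word []      = []
  word (a ∷ s) = inject₁ a ∷ word s
  word (kk∷ s) = fromℕ (suc m) ∷ fromℕ (suc m) ∷ word s

  word-concat : ∀ {n} (s : Str n) → Concat (word s)
  word-concat []      = []
  word-concat (a ∷ s) = letter (fromℕ≢inject₁ ∘ sym) (word-concat s)
  word-concat (kk∷ s) = pair (word-concat s)

  concat⇒word : ∀ {n} {w : Word (suc m) n} → Concat w → ∃ λ s → word s ≡ w
  concat⇒word [] = [] , refl
  concat⇒word (letter {a = a} a≢ c) with view a | concat⇒word c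
  ... | ‵fromℕ     | _        = contradiction refl a≢
  ... | ‵inject₁ i | s , refl = i ∷ s , refl
  concat⇒word (pair c) with concat⇒word c
  ... | s , refl = kk∷ s , refl

  word-injective : ∀ {n} {s r : Str n} → word s ≡ word r → s ≡ r
  word-injective {s = []}    {[]}    eq = refl
  word-injective {s = a ∷ s} {b ∷ r} eq =
    cong₂ _∷_ (inject₁-injective (∷-injectiveˡ eq)) (word-injective (∷-injectiveʳ eq))
  word-injective {s = a ∷ s} {kk∷ r} eq = contradiction (sym (∷-injectiveˡ eq)) fromℕ≢inject₁
  word-injective {s = kk∷ s} {b ∷ r} eq = contradiction (∷-injectiveˡ eq) fromℕ≢inject₁
  word-injective {s = kk∷ s} {kk∷ r} eq = cong kk∷_ (word-injective (∷-injectiveʳ (∷-injectiveʳ eq)))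

  Add⇒⟶ : ∀ {n} {b : Block n} {s r} → Add b s r → word s ⟶ word r
  Add⇒⟶ single      = single (λ ()) (fromℕ≢inject₁ ∘ sym)
  Add⇒⟶ double      = double
  Add⇒⟶ (next e)    = there (Add⇒⟶ e)
  Add⇒⟶ (next-kk e) = there (there (Add⇒⟶ e))

  -- The words are generalised to `w` and `v` so that the step can be matched. Since `fromℕ (suc m)`
  -- is neither `zero` nor of the form `inject₁ a`, a step leaves a `kk` alone or writes it as a
  -- whole.
  ⟶⇒Add : ∀ {n} (s r : Str n) {w v} → w ⟶ v → word s ≡ w → word r ≡ v → ∃ λ b → Add b s r
  ⟶⇒Add (zero ∷ s) (zero ∷ r)  (single i≢0 i≢k) eq eq′ = contradiction (sym (∷-injectiveˡ eq′)) i≢0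
  ⟶⇒Add (zero ∷ s) (suc i ∷ r) (single i≢0 i≢k) eq eq′
    with refl ← word-injective {s = s} {r} (trans (∷-injectiveʳ eq) (sym (∷-injectiveʳ eq′))) = single i , single
  ⟶⇒Add (suc _ ∷ s) _          (single i≢0 i≢k) eq eq′ = contradiction (∷-injectiveˡ eq) λ ()
  ⟶⇒Add (zero ∷ s) (kk∷ r)     (single i≢0 i≢k) eq eq′ = contradiction (sym (∷-injectiveˡ eq′)) i≢k
  ⟶⇒Add (kk∷ s)    _           (single i≢0 i≢k) eq eq′ = contradiction (∷-injectiveˡ eq) λ ()
  ⟶⇒Add (zero ∷ zero ∷ s) (kk∷ r) double eq eq′
    with refl ← word-injective {s = s} {r}
                  (trans (∷-injectiveʳ (∷-injectiveʳ eq)) (sym (∷-injectiveʳ (∷-injectiveʳ eq′)))) = double , double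
  ⟶⇒Add (suc _ ∷ s) _          double eq eq′ = contradiction (∷-injectiveˡ eq) λ ()
  ⟶⇒Add (zero ∷ suc _ ∷ s) _   double eq eq′ = contradiction (∷-injectiveˡ (∷-injectiveʳ eq)) λ ()
  ⟶⇒Add (zero ∷ kk∷ s) _       double eq eq′ = contradiction (∷-injectiveˡ (∷-injectiveʳ eq)) λ ()
  ⟶⇒Add (kk∷ s) _              double eq eq′ = contradiction (∷-injectiveˡ eq) λ ()
  ⟶⇒Add (a ∷ s) (b ∷ r)        double eq eq′ = contradiction (sym (∷-injectiveˡ eq′)) fromℕ≢inject₁
  ⟶⇒Add (a ∷ s) (b ∷ r) (there e) eq eq′
    with refl ← inject₁-injective {i = a} {b} (trans (∷-injectiveˡ eq) (sym (∷-injectiveˡ eq′)))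
       | c , e′ ← ⟶⇒Add s r e (∷-injectiveʳ eq) (∷-injectiveʳ eq′) = next c , next e′
  ⟶⇒Add (a ∷ s) (kk∷ r) (there e) eq eq′ =
    contradiction (trans (∷-injectiveˡ eq′) (sym (∷-injectiveˡ eq))) fromℕ≢inject₁
  ⟶⇒Add (kk∷ s) (b ∷ r) (there e) eq eq′ =
    contradiction (trans (∷-injectiveˡ eq) (sym (∷-injectiveˡ eq′))) fromℕ≢inject₁
  ⟶⇒Add (kk∷ s) (kk∷ r) (there (single i≢0 i≢k)) eq eq′ = contradiction (∷-injectiveˡ (∷-injectiveʳ eq)) λ ()
  ⟶⇒Add (kk∷ s) (kk∷ r) (there double) eq eq′ = contradiction (∷-injectiveˡ (∷-injectiveʳ eq)) λ ()
  ⟶⇒Add (kk∷ s) (kk∷ r) (there (there e)) eq eq′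
    with c , e′ ← ⟶⇒Add s r e (∷-injectiveʳ (∷-injectiveʳ eq)) (∷-injectiveʳ (∷-injectiveʳ eq′)) =
    next (next c) , next-kk e′

  Linked : ∀ {n} → Word (suc m) n → Word (suc m) n → Set
  Linked w v = w ⟶ v ⊎ v ⟶ w

  Adjacent⇒Linked : ∀ {n} {s r : Str n} → Adjacent s r → Linked (word s) (word r)
  Adjacent⇒Linked (b , e) = Sum.map Add⇒⟶ Add⇒⟶ e

  Linked⇒Adjacent : ∀ {n} {s r : Str n} → Linked (word s) (word r) → Adjacent s r
  Linked⇒Adjacent {s = s} {r} (inj₁ e) with b , e′ ← ⟶⇒Add s r e refl refl = b , inj₁ e′
  Linked⇒Adjacent {s = s} {r} (inj₂ e) with b , e′ ← ⟶⇒Add r s e refl refl = b , inj₂ e′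

  parse : ∀ {n} (v : PellString n (suc m)) → ∃ λ s → word s ≡ value v
  -- The proof in a refinement is irrelevant; deciding `IsPell` again makes it usable.
  parse (w , [ w-pell ]) = concat⇒word (IsPell⇒Concat w (recompute (isPell? w) w-pell))

  Str↔PellString : ∀ {n} → Str n ↔ PellString n (suc m)
  Str↔PellString = mk↔ₛ′
    (λ s → word s , [ Concat⇒IsPell (word-concat s) ])
    (proj₁ ∘ parse)
    (value-injective ∘ proj₂ ∘ parse)
    (λ s → word-injective (proj₂ (parse (word s , [ Concat⇒IsPell (word-concat s) ]))))

  -- A `Vec Bool p` is a `Subset p`, so `anySubset?` searches all vertices; strings are compared
  -- through their words.
  _∈ᶜ?_ : ∀ {n p} (s : Str n) (c : Cube n p) → Dec (s ∈ c)
  s ∈ᶜ? c = map′ (λ { (x , eq) → subst (_∈ c) (word-injective eq) (vertex∈ c x) })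
                 (λ s∈ → let x , eq = ∈⇒vertex s∈ in x , cong word eq)
                 (anySubset? λ x → ≡-dec Fin._≟_ (word (vertex c x)) (word s))

  -- Counting cubes

  module _ (n p : ℕ) where
    private
      G = munarini n (suc m)
      module G = FiniteGraph G

    index : Str n ↔ Fin G.order
    index = G.index ↔-∘ Str↔PellString

    private
      module I = Inverse index
      module G-index = Inverse G.index
      module S = Inverse (Str↔PellString {n})

    vertices : Cube n p → Subset G.order
    vertices c = tabulate λ i → does (I.from i ∈ᶜ? c)

    ∈-vertices⁺ : ∀ {c i} → I.from i ∈ c → i ∈ˢ vertices c
    ∈-vertices⁺ {c} {i} s∈ = lookup⇒[]= i _ (trans (lookup∘tabulate _ i) (dec-true (I.from i ∈ᶜ? c) s∈))

    ∈-vertices⁻ : ∀ {c i} → i ∈ˢ vertices c → I.from i ∈ c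
    ∈-vertices⁻ {c} {i} i∈ with I.from i ∈ᶜ? c in eq
    ... | yes s∈ = s∈
    ... | no _ = contradiction (trans (sym ([]=⇒lookup i∈)) (trans (lookup∘tabulate _ i) (cong does eq))) λ ()

    vertices-injective : ∀ {c d} → vertices c ≡ vertices d → c ≡ d
    vertices-injective {c} {d} eq = ∈-ext c d (transport eq) (transport (sym eq))
      where
      transport : ∀ {c d s} → vertices c ≡ vertices d → s ∈ c → s ∈ d
      transport {c} {d} {s} eq s∈ = subst (_∈ d) (I.strictlyInverseʳ s)
        (∈-vertices⁻ (subst (I.to s ∈ˢ_) eq (∈-vertices⁺ (subst (_∈ c) (sym (I.strictlyInverseʳ s)) s∈))))

    vertices-≅ : ∀ c → induced G (vertices c) ≅ hypercube p
    vertices-≅ c = record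
      { bijection = mk↔ₛ′ to from to∘from from∘to
      ; adjacency = λ u v → mk⇔
          (λ e → ∼⇒Adj (vertex-Adjacent⁻ c (Linked⇒Adjacent (subst₂ Linked (sym (word-to u)) (sym (word-to v)) e))))
          (λ e → subst₂ Linked (word-to u) (word-to v) (Adjacent⇒Linked (vertex-Adjacent⁺ c (Adj⇒∼ e))))
      }
      where
      V = Graph.Vertex (induced G (vertices c))

      parse∈ : (v : V) → S.from (value v) ∈ c
      parse∈ (v , [ v∈ ]) = subst (λ u → S.from u ∈ c) (G-index.strictlyInverseʳ v)
        (∈-vertices⁻ (recompute (G-index.to v ∈? vertices c) v∈))

      to : V → Vec Bool p
      to v = proj₁ (∈⇒vertex (parse∈ v))

      vertex-to : ∀ v → vertex c (to v) ≡ S.from (value v)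
      vertex-to v = proj₂ (∈⇒vertex (parse∈ v))

      word-to : ∀ v → word (vertex c (to v)) ≡ value (value v)
      word-to v = trans (cong word (vertex-to v)) (proj₂ (parse (value v)))

      from : Vec Bool p → V
      from x = S.to (vertex c x) , [ ∈-vertices⁺ (subst (_∈ c) (sym (I.strictlyInverseʳ (vertex c x))) (vertex∈ c x)) ]

      to∘from : ∀ x → to (from x) ≡ x
      to∘from x = vertex-injective c (trans (vertex-to (from x)) (S.strictlyInverseʳ (vertex c x)))

      from∘to : ∀ v → from (to v) ≡ v
      -- Such a vertex is a word refined twice: it is Pell, and its index lies in `vertices c`.
      from∘to v = value-injective (value-injective (word-to v))

    ≅⇒vertices : ∀ S → induced G S ≅ hypercube p → ∃ λ c → vertices c ≡ S
    ≅⇒vertices S iso = c , ⊆-antisym c⊆S S⊆c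
      where
      open _≅_ iso
      module B = Inverse bijection

      f : Vec Bool p → Str n
      f x = S.from (value (B.from x))

      word-f : ∀ x → word (f x) ≡ value (value (B.from x))
      word-f x = proj₂ (parse (value (B.from x)))

      f-embedding : IsEmbedding f
      f-embedding = record
        { injective = λ {x} {y} eq → trans (sym (B.strictlyInverseˡ x)) (trans
            (cong B.to (value-injective (value-injective (trans (sym (word-f x)) (trans (cong word eq) (word-f y))))))
            (B.strictlyInverseˡ y))
        ; adjacent = λ {x} {y} e → Linked⇒Adjacent (subst₂ Linked (sym (word-f x)) (sym (word-f y))
            (Equivalence.from (adjacency (B.from x) (B.from y))
              (subst₂ (Graph.Adj (hypercube p)) (sym (B.strictlyInverseˡ x)) (sym (B.strictlyInverseˡ y)) (∼⇒Adj e))))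
        }

      c : Cube n p
      c = proj₁ (embedding⇒cube p f f-embedding)

      spans : Spans c f
      spans = proj₂ (embedding⇒cube p f f-embedding)

      index-f∈ : ∀ x → I.to (f x) ∈ˢ S
      index-f∈ x with B.from x
      ... | v , [ v∈ ] = subst (λ u → G-index.to u ∈ˢ S) (sym (S.strictlyInverseˡ v)) (recompute (G-index.to v ∈? S) v∈)

      c⊆S : ∀ {i} → i ∈ˢ vertices c → i ∈ˢ S
      c⊆S {i} i∈ with x , eq ← Equivalence.to (spans _) (∈-vertices⁻ i∈) =
        subst (_∈ˢ S) (trans (cong I.to eq) (I.strictlyInverseˡ i)) (index-f∈ x)

      S⊆c : ∀ {i} → i ∈ˢ S → i ∈ˢ vertices c
      S⊆c {i} i∈ = ∈-vertices⁺ (Equivalence.from (spans _) (B.to v , cong (S.from ∘ value) (B.strictlyInverseʳ v)))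
        where
        v : Graph.Vertex (induced G S)
        v = G-index.from i , [ subst (_∈ˢ S) (sym (G-index.strictlyInverseˡ i)) i∈ ]

  -- Enumeration of the cube words

  fixes : ∀ {n p} → List (Cube n p) → List (Cube (suc n) p)
  fixes = cartesianProductWith fix (allFin (suc m))

  edges : ∀ {n p} → List (Cube n p) → List (Cube (suc n) (suc p))
  edges = cartesianProductWith edge (allFin m)

  kks : ∀ {n p} → List (Cube n p) → List (Cube (suc (suc n)) p)
  kks = map kk

  kk-edges : ∀ {n p} → List (Cube n p) → List (Cube (suc (suc n)) (suc p))
  kk-edges = map kk-edge

  -- A word of length 1 has no room for a `kk`, and one of dimension 0 has no free symbol, hence the
  -- separate clauses. The four summands of the last clause become the terms `k t`, `(k-1) x t`,
  -- `t^2` and `x t^2` of the denominator.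
  cubes : ∀ n p → List (Cube n p)
  cubes 0             zero    = [] ∷ []
  cubes 0             (suc p) = []
  cubes 1             zero    = fixes (cubes 0 zero)
  cubes 1             (suc p) = fixes (cubes 0 (suc p)) ++ edges (cubes 0 p)
  cubes (suc (suc n)) zero    = fixes (cubes (suc n) zero) ++ kks (cubes n zero)
  cubes (suc (suc n)) (suc p) =
    fixes (cubes (suc n) (suc p)) ++ edges (cubes (suc n) p) ++ kks (cubes n (suc p)) ++ kk-edges (cubes n p)

  ∈-fixes⁺ : ∀ {n p a} {c : Cube n p} {cs} → c ∈ₗ cs → fix a c ∈ₗ fixes cs
  ∈-fixes⁺ {a = a} = ∈-cartesianProductWith⁺ fix (∈-allFin a)

  ∈-edges⁺ : ∀ {n p i} {c : Cube n p} {cs} → c ∈ₗ cs → edge i c ∈ₗ edges cs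
  ∈-edges⁺ {i = i} = ∈-cartesianProductWith⁺ edge (∈-allFin i)

  ∈-cubes : ∀ {n p} (c : Cube n p) → c ∈ₗ cubes n p
  ∈-cubes {0}           {zero}  []          = here refl
  ∈-cubes {1}           {zero}  (fix a c)   = ∈-fixes⁺ (∈-cubes c)
  ∈-cubes {1}           {suc p} (fix a c)   = ∈-++⁺ˡ (∈-fixes⁺ (∈-cubes c))
  ∈-cubes {1}           {suc p} (edge i c)  = ∈-++⁺ʳ (fixes (cubes 0 (suc p))) (∈-edges⁺ (∈-cubes c))
  ∈-cubes {suc (suc n)} {zero}  (fix a c)   = ∈-++⁺ˡ (∈-fixes⁺ (∈-cubes c))
  ∈-cubes {suc (suc n)} {zero}  (kk c)      = ∈-++⁺ʳ (fixes (cubes (suc n) zero)) (∈-map⁺ kk (∈-cubes c))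
  ∈-cubes {suc (suc n)} {suc p} (fix a c)   = ∈-++⁺ˡ (∈-fixes⁺ (∈-cubes c))
  ∈-cubes {suc (suc n)} {suc p} (edge i c)  =
    ∈-++⁺ʳ (fixes (cubes (suc n) (suc p))) (∈-++⁺ˡ (∈-edges⁺ (∈-cubes c)))
  ∈-cubes {suc (suc n)} {suc p} (kk c)      =
    ∈-++⁺ʳ (fixes (cubes (suc n) (suc p))) (∈-++⁺ʳ (edges (cubes (suc n) p)) (∈-++⁺ˡ (∈-map⁺ kk (∈-cubes c))))
  ∈-cubes {suc (suc n)} {suc p} (kk-edge c) =
    ∈-++⁺ʳ (fixes (cubes (suc n) (suc p))) (∈-++⁺ʳ (edges (cubes (suc n) p))
      (∈-++⁺ʳ (kks (cubes n (suc p))) (∈-map⁺ kk-edge (∈-cubes c))))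

  fixes-unique : ∀ {n p} {cs : List (Cube n p)} → Unique cs → Unique (fixes cs)
  fixes-unique = Unique.cartesianProductWith⁺ fix (λ { refl → refl , refl }) (Unique.allFin⁺ (suc m))

  edges-unique : ∀ {n p} {cs : List (Cube n p)} → Unique cs → Unique (edges cs)
  edges-unique = Unique.cartesianProductWith⁺ edge (λ { refl → refl , refl }) (Unique.allFin⁺ m)

  kks-unique : ∀ {n p} {cs : List (Cube n p)} → Unique cs → Unique (kks cs)
  kks-unique = Unique.map⁺ λ { refl → refl }

  kk-edges-unique : ∀ {n p} {cs : List (Cube n p)} → Unique cs → Unique (kk-edges cs)
  kk-edges-unique = Unique.map⁺ λ { refl → refl }

  fixes-disjoint : ∀ {n p} (cs : List (Cube n p)) {ds} → (∀ {a c} → ¬ fix a c ∈ₗ ds) → Disjoint (fixes cs) ds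
  fixes-disjoint cs ∉ds (x∈ , x∈ds)
    with _ , _ , _ , _ , refl ← ∈-cartesianProductWith⁻ fix (allFin (suc m)) cs x∈ = ∉ds x∈ds

  edges-disjoint : ∀ {n p} (cs : List (Cube n p)) {ds} → (∀ {i c} → ¬ edge i c ∈ₗ ds) → Disjoint (edges cs) ds
  edges-disjoint cs ∉ds (x∈ , x∈ds)
    with _ , _ , _ , _ , refl ← ∈-cartesianProductWith⁻ edge (allFin m) cs x∈ = ∉ds x∈ds

  fix∉edges : ∀ {n p a c} (cs : List (Cube n p)) → ¬ fix a c ∈ₗ edges cs
  fix∉edges cs x∈ with _ , _ , _ , _ , () ← ∈-cartesianProductWith⁻ edge (allFin m) cs x∈

  kks-kk-edges-disjoint : ∀ {n p} (cs : List (Cube n (suc p))) ds → Disjoint (kks cs) (kk-edges ds)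
  kks-kk-edges-disjoint cs ds (x∈ , x∈′) with _ , _ , refl ← ∈-map⁻ kk x∈ = ∉-map ds (λ ()) x∈′

  cubes-unique : ∀ n p → Unique (cubes n p)
  cubes-unique 0             zero    = [] ∷ []
  cubes-unique 0             (suc p) = []
  cubes-unique 1             zero    = fixes-unique (cubes-unique 0 zero)
  cubes-unique 1             (suc p) = Unique.++⁺
    (fixes-unique (cubes-unique 0 (suc p)))
    (edges-unique (cubes-unique 0 p))
    (fixes-disjoint (cubes 0 (suc p)) (fix∉edges (cubes 0 p)))
  cubes-unique (suc (suc n)) zero    = Unique.++⁺
    (fixes-unique (cubes-unique (suc n) zero))
    (kks-unique (cubes-unique n zero))
    (fixes-disjoint (cubes (suc n) zero) (∉-map (cubes n zero) λ ()))
  cubes-unique (suc (suc n)) (suc p) = Unique.++⁺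
    (fixes-unique (cubes-unique (suc n) (suc p)))
    (Unique.++⁺
      (edges-unique (cubes-unique (suc n) p))
      (Unique.++⁺
        (kks-unique (cubes-unique n (suc p)))
        (kk-edges-unique (cubes-unique n p))
        (kks-kk-edges-disjoint (cubes n (suc p)) (cubes n p)))
      (edges-disjoint (cubes (suc n) p)
        (∉-++ (kks (cubes n (suc p))) (∉-map (cubes n (suc p)) λ ()) (∉-map (cubes n p) λ ()))))
    (fixes-disjoint (cubes (suc n) (suc p))
      (∉-++ (edges (cubes (suc n) p)) (fix∉edges (cubes (suc n) p))
        (∉-++ (kks (cubes n (suc p))) (∉-map (cubes n (suc p)) λ ()) (∉-map (cubes n p) λ ()))))

  cubeCount≡length-cubes : ∀ n p → cubeCount (munarini n (suc m)) p ≡ length (cubes n p)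
  cubeCount≡length-cubes n p = length-filter-image (induced≅hypercube? (munarini n (suc m)) p) (vertices n p)
    (allVecs-unique (((λ ()) ∷ []) ∷ [] ∷ []) (FiniteGraph.order (munarini n (suc m))))
    (∈-allVecs λ { true → here refl ; false → there (here refl) })
    (cubes-unique n p) ∈-cubes (vertices-injective n p) (vertices-≅ n p) (≅⇒vertices n p)

  length-fixes : ∀ {n p} (cs : List (Cube n p)) → length (fixes cs) ≡ suc m · length cs
  length-fixes cs = trans (length-cartesianProductWith fix (allFin (suc m)) cs)
                          (cong (_· length cs) (length-tabulate {n = suc m} id))

  length-edges : ∀ {n p} (cs : List (Cube n p)) → length (edges cs) ≡ m · length cs
  length-edges cs = trans (length-cartesianProductWith edge (allFin m) cs)
                          (cong (_· length cs) (length-tabulate {n = m} id))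

  length-cubes-1-0 : length (cubes 1 0) ≡ suc m · length (cubes 0 0)
  length-cubes-1-0 = length-fixes (cubes 0 0)

  length-cubes-1-suc : ∀ p → length (cubes 1 (suc p)) ≡ suc m · length (cubes 0 (suc p)) + m · length (cubes 0 p)
  length-cubes-1-suc p = trans
    (length-++ (fixes (cubes 0 (suc p))))
    (cong₂ _+_ (length-fixes (cubes 0 (suc p))) (length-edges (cubes 0 p)))

  length-cubes-0 : ∀ n → length (cubes (suc (suc n)) 0) ≡ suc m · length (cubes (suc n) 0) + length (cubes n 0)
  length-cubes-0 n = trans
    (length-++ (fixes (cubes (suc n) 0)))
    (cong₂ _+_ (length-fixes (cubes (suc n) 0)) (length-map kk (cubes n 0)))

  length-cubes-suc : ∀ n p → length (cubes (suc (suc n)) (suc p)) ≡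
                     suc m · length (cubes (suc n) (suc p)) + (m · length (cubes (suc n) p) +
                     (length (cubes n (suc p)) + length (cubes n p)))
  length-cubes-suc n p = trans
    (length-++ (fixes (cubes (suc n) (suc p))))
    (cong₂ _+_ (length-fixes (cubes (suc n) (suc p))) (trans
      (length-++ (edges (cubes (suc n) p)))
      (cong₂ _+_ (length-edges (cubes (suc n) p)) (trans
        (length-++ (kks (cubes n (suc p))))
        (cong₂ _+_ (length-map kk (cubes n (suc p))) (length-map kk-edge (cubes n p)))))))

-- Polynomials and power series

coeff-+ₚ : ∀ f g i → coeff (f +ₚ g) i ≡ coeff f i ℤ.+ coeff g i
coeff-+ₚ []      g       i       = sym (ℤ.+-identityˡ _)
coeff-+ₚ (a ∷ f) []      i       = sym (ℤ.+-identityʳ _)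
coeff-+ₚ (a ∷ f) (b ∷ g) zero    = refl
coeff-+ₚ (a ∷ f) (b ∷ g) (suc i) = coeff-+ₚ f g i

coeff--ₚ : ∀ f i → coeff (-ₚ f) i ≡ ℤ.- coeff f i
coeff--ₚ []      i       = refl
coeff--ₚ (a ∷ f) zero    = refl
coeff--ₚ (a ∷ f) (suc i) = coeff--ₚ f i

coeff-scale : ∀ a f i → coeff (map (a ℤ.*_) f) i ≡ a ℤ.* coeff f i
coeff-scale a []      i       = sym (ℤ.*-zeroʳ a)
coeff-scale a (b ∷ f) zero    = refl
coeff-scale a (b ∷ f) (suc i) = coeff-scale a f i

coeff-∷-*ₚ : ∀ a f g i → coeff ((a ∷ f) *ₚ g) i ≡ a ℤ.* coeff g i ℤ.+ coeff (0ℤ ∷ f *ₚ g) i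
coeff-∷-*ₚ a f g i = trans (coeff-+ₚ (map (a ℤ.*_) g) (0ℤ ∷ f *ₚ g) i) (cong (ℤ._+ _) (coeff-scale a g i))

∷-cong : ∀ {a b f g} → a ≡ b → f ≈ₚ g → a ∷ f ≈ₚ b ∷ g
∷-cong a≡b f≈g zero    = a≡b
∷-cong a≡b f≈g (suc i) = f≈g i

0∷-zero : ∀ {f} → f ≈ₚ 0ₚ → 0ℤ ∷ f ≈ₚ 0ₚ
0∷-zero f≈0 zero    = refl
0∷-zero f≈0 (suc i) = f≈0 i

*ₚ-congʳ : ∀ f {g h} → g ≈ₚ h → f *ₚ g ≈ₚ f *ₚ h
*ₚ-congʳ []      g≈h i = refl
*ₚ-congʳ (a ∷ f) {g} {h} g≈h i = begin
  coeff ((a ∷ f) *ₚ g) i                        ≡⟨ coeff-∷-*ₚ a f g i ⟩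
  a ℤ.* coeff g i ℤ.+ coeff (0ℤ ∷ f *ₚ g) i     ≡⟨ cong₂ ℤ._+_ (cong (a ℤ.*_) (g≈h i)) (∷-cong refl (*ₚ-congʳ f g≈h) i) ⟩
  a ℤ.* coeff h i ℤ.+ coeff (0ℤ ∷ f *ₚ h) i     ≡⟨ coeff-∷-*ₚ a f h i ⟨
  coeff ((a ∷ f) *ₚ h) i                        ∎
  where open ≡-Reasoning

-- A zero polynomial may be a nonempty list of zeros. This lemma lets `*ₚ-congˡ` compare lists of
-- different lengths.
*ₚ-zeroˡ : ∀ f g → f ≈ₚ 0ₚ → f *ₚ g ≈ₚ 0ₚ
*ₚ-zeroˡ []      g f≈0 i = refl
*ₚ-zeroˡ (a ∷ f) g f≈0 i = trans (coeff-∷-*ₚ a f g i)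
  (cong₂ ℤ._+_ (cong (ℤ._* coeff g i) (f≈0 0)) (0∷-zero (*ₚ-zeroˡ f g (f≈0 ∘ suc)) i))

*ₚ-congˡ : ∀ {f g} h → f ≈ₚ g → f *ₚ h ≈ₚ g *ₚ h
*ₚ-congˡ {[]}    {g}     h f≈g i = sym (*ₚ-zeroˡ g h (sym ∘ f≈g) i)
*ₚ-congˡ {a ∷ f} {[]}    h f≈g i = *ₚ-zeroˡ (a ∷ f) h f≈g i
*ₚ-congˡ {a ∷ f} {b ∷ g} h f≈g i = begin
  coeff ((a ∷ f) *ₚ h) i                        ≡⟨ coeff-∷-*ₚ a f h i ⟩
  a ℤ.* coeff h i ℤ.+ coeff (0ℤ ∷ f *ₚ h) i     ≡⟨ cong₂ ℤ._+_ (cong (ℤ._* coeff h i) (f≈g 0)) (∷-cong refl (*ₚ-congˡ {f} {g} h (f≈g ∘ suc)) i) ⟩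
  b ℤ.* coeff h i ℤ.+ coeff (0ℤ ∷ g *ₚ h) i     ≡⟨ coeff-∷-*ₚ b g h i ⟨
  coeff ((b ∷ g) *ₚ h) i                        ∎
  where open ≡-Reasoning

*ₚ-zeroʳ : ∀ f → f *ₚ 0ₚ ≈ₚ 0ₚ
*ₚ-zeroʳ []      i = refl
*ₚ-zeroʳ (a ∷ f) i = 0∷-zero (*ₚ-zeroʳ f) i

*ₚ-identityʳ : ∀ f → f *ₚ 1ₚ ≈ₚ f
*ₚ-identityʳ []      i       = refl
*ₚ-identityʳ (a ∷ f) zero    = trans (ℤ.+-identityʳ _) (ℤ.*-identityʳ a)
*ₚ-identityʳ (a ∷ f) (suc i) = *ₚ-identityʳ f i

*ₚ-identityˡ : ∀ f → 1ₚ *ₚ f ≈ₚ f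
*ₚ-identityˡ f i = trans (coeff-∷-*ₚ 1ℤ [] f i)
  (trans (cong₂ ℤ._+_ (ℤ.*-identityˡ (coeff f i)) (0∷-zero {[]} (λ _ → refl) i)) (ℤ.+-identityʳ _))

-- The coefficients of `t` and `t^2` in the denominator are linear in `X`, so products with them are
-- governed by this formula and the next.
coeff-linear-*ₚ-zero : ∀ a b f → coeff ((a ∷ b ∷ []) *ₚ f) 0 ≡ a ℤ.* coeff f 0
coeff-linear-*ₚ-zero a b f = trans (coeff-∷-*ₚ a (b ∷ []) f 0) (ℤ.+-identityʳ _)

coeff-linear-*ₚ-suc : ∀ a b f i → coeff ((a ∷ b ∷ []) *ₚ f) (suc i) ≡ a ℤ.* coeff f (suc i) ℤ.+ b ℤ.* coeff f i
coeff-linear-*ₚ-suc a b f i = begin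
  coeff ((a ∷ b ∷ []) *ₚ f) (suc i)                                    ≡⟨ coeff-∷-*ₚ a (b ∷ []) f (suc i) ⟩
  a ℤ.* coeff f (suc i) ℤ.+ coeff ((b ∷ []) *ₚ f) i                    ≡⟨ cong (ℤ._+_ (a ℤ.* coeff f (suc i))) (begin
    coeff ((b ∷ []) *ₚ f) i                    ≡⟨ coeff-∷-*ₚ b [] f i ⟩
    b ℤ.* coeff f i ℤ.+ coeff (0ℤ ∷ []) i      ≡⟨ cong (ℤ._+_ (b ℤ.* coeff f i)) (0∷-zero {[]} (λ _ → refl) i) ⟩
    b ℤ.* coeff f i ℤ.+ 0ℤ                     ≡⟨ ℤ.+-identityʳ _ ⟩
    b ℤ.* coeff f i                            ∎) ⟩
  a ℤ.* coeff f (suc i) ℤ.+ b ℤ.* coeff f i                            ∎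
  where open ≡-Reasoning

-- Peeling terms off `upTo` leaves `applyUpTo` of a shifted function; a general `g` covers all these
-- tails.
sum-zero : ∀ (f : ℕ → Poly) (g : ℕ → ℕ) n → (∀ j → f (g j) ≈ₚ 0ₚ) → foldr _+ₚ_ 0ₚ (map f (applyUpTo g n)) ≈ₚ 0ₚ
sum-zero f g zero    f≈0 i = refl
sum-zero f g (suc n) f≈0 i = trans (coeff-+ₚ (f (g 0)) _ i)
  (cong₂ ℤ._+_ (f≈0 0 i) (sum-zero f (g ∘ suc) n (f≈0 ∘ suc) i))

constₛ-* : ∀ f G n → (constₛ f * G) n ≈ₚ f *ₚ G n
constₛ-* f G n i = trans (coeff-+ₚ (f *ₚ G n) _ i) (trans
  (cong (ℤ._+_ (coeff (f *ₚ G n) i)) (sum-zero (λ j → constₛ f j *ₚ G (n ∸ j)) suc n (λ _ _ → refl) i))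
  (ℤ.+-identityʳ _))

t*t≈0 : ∀ n → (t * t) (suc (suc (suc n))) ≈ₚ 0ₚ
t*t≈0 n i = trans
  -- The summand with `t 0` vanishes by computation, the next one is `t 1` times a zero coefficient,
  -- and from index 2 on the left factor is `0ₚ`.
  (coeff-+ₚ (1ₚ *ₚ 0ₚ) (foldr _+ₚ_ 0ₚ (map term (applyUpTo (_+_ 2) (suc (suc n))))) i)
  (cong₂ ℤ._+_ (*ₚ-zeroʳ 1ₚ i) (sum-zero term (_+_ 2) (suc (suc n)) (λ _ _ → refl) i))
  where
  term : ℕ → Poly
  term j = t j *ₚ t (suc (suc (suc n)) ∸ j)

-- Coefficients of the denominator

denominator : Poly → Poly → Poly → PowerSeries
denominator f g h = 1ₛ - constₛ f * t - constₛ g * t - constₛ h * (t * t)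

module _ (f g h : Poly) where

  private
    D = denominator f g h

    coeff-D : ∀ n i → coeff (D n) i ≡ coeff (1ₛ n) i ℤ.- coeff (f *ₚ t n) i ℤ.- coeff (g *ₚ t n) i ℤ.- coeff (h *ₚ (t * t) n) i
    coeff-D n i = trans (coeff-- (1ₛ - constₛ f * t - constₛ g * t) (constₛ h * (t * t))) (cong₂ ℤ._-_
      (trans (coeff-- (1ₛ - constₛ f * t) (constₛ g * t)) (cong₂ ℤ._-_
        (trans (coeff-- 1ₛ (constₛ f * t)) (cong (ℤ._-_ (coeff (1ₛ n) i)) (constₛ-* f t n i)))
        (constₛ-* g t n i)))
      (constₛ-* h (t * t) n i))
      where
      coeff-- : ∀ F G → coeff ((F - G) n) i ≡ coeff (F n) i ℤ.- coeff (G n) i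
      coeff-- F G = trans (coeff-+ₚ (F n) (-ₚ G n) i) (cong (ℤ._+_ (coeff (F n) i)) (coeff--ₚ (G n) i))

    from-terms : ∀ n i {b c d} → coeff (f *ₚ t n) i ≡ b → coeff (g *ₚ t n) i ≡ c → coeff (h *ₚ (t * t) n) i ≡ d →
                 coeff (D n) i ≡ coeff (1ₛ n) i ℤ.- b ℤ.- c ℤ.- d
    from-terms n i refl refl refl = coeff-D n i

    *ₚ-vanishes : ∀ e {s} → s ≈ₚ 0ₚ → e *ₚ s ≈ₚ 0ₚ
    *ₚ-vanishes e s≈0 i = trans (*ₚ-congʳ e s≈0 i) (*ₚ-zeroʳ e i)

  denominator-0 : D 0 ≈ₚ 1ₚ
  denominator-0 i = trans
    (from-terms 0 i (*ₚ-zeroʳ f i) (*ₚ-zeroʳ g i) (*ₚ-zeroʳ h i))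
    (zeros (coeff 1ₚ i))
    where
    zeros : ∀ a → a ℤ.- 0ℤ ℤ.- 0ℤ ℤ.- 0ℤ ≡ a
    zeros = solve-∀

  denominator-1 : D 1 ≈ₚ -ₚ (f +ₚ g)
  denominator-1 i = trans
    -- `(t * t) 1` evaluates to `0ℤ ∷ []`, which is `0ₚ` only up to `≈ₚ`.
    (from-terms 1 i (*ₚ-identityʳ f i) (*ₚ-identityʳ g i) (*ₚ-vanishes h (0∷-zero {[]} (λ _ → refl)) i))
    (trans (rearrange (coeff f i) (coeff g i))
      (sym (trans (coeff--ₚ (f +ₚ g) i) (cong ℤ.-_ (coeff-+ₚ f g i)))))
    where
    rearrange : ∀ a b → 0ℤ ℤ.- a ℤ.- b ℤ.- 0ℤ ≡ ℤ.- (a ℤ.+ b)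
    rearrange = solve-∀

  denominator-2 : D 2 ≈ₚ -ₚ h
  denominator-2 i = trans
    (from-terms 2 i (*ₚ-zeroʳ f i) (*ₚ-zeroʳ g i) (*ₚ-identityʳ h i))
    (trans (zeros (coeff h i)) (sym (coeff--ₚ h i)))
    where
    zeros : ∀ a → 0ℤ ℤ.- 0ℤ ℤ.- 0ℤ ℤ.- a ≡ ℤ.- a
    zeros = solve-∀

  denominator-≥3 : ∀ n → D (suc (suc (suc n))) ≈ₚ 0ₚ
  denominator-≥3 n i =
    from-terms (suc (suc (suc n))) i (*ₚ-zeroʳ f i) (*ₚ-zeroʳ g i) (*ₚ-vanishes h (t*t≈0 n) i)

  module _ (F : PowerSeries) (i : ℕ) where

    denominator-*-0 : coeff ((D * F) 0) i ≡ coeff (F 0) i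
    denominator-*-0 = trans (coeff-+ₚ (D 0 *ₚ F 0) 0ₚ i) (trans
      (cong (ℤ._+ 0ℤ) (trans (*ₚ-congˡ {D 0} {1ₚ} (F 0) denominator-0 i) (*ₚ-identityˡ (F 0) i)))
      (ℤ.+-identityʳ _))

    denominator-*-1 : coeff ((D * F) 1) i ≡ coeff (F 1) i ℤ.+ coeff (-ₚ (f +ₚ g) *ₚ F 0) i
    denominator-*-1 = trans (coeff-+ₚ (D 0 *ₚ F 1) (D 1 *ₚ F 0 +ₚ 0ₚ) i) (cong₂ ℤ._+_
      (trans (*ₚ-congˡ {D 0} {1ₚ} (F 1) denominator-0 i) (*ₚ-identityˡ (F 1) i))
      (trans (coeff-+ₚ (D 1 *ₚ F 0) 0ₚ i) (trans (ℤ.+-identityʳ _) (*ₚ-congˡ {D 1} { -ₚ (f +ₚ g)} (F 0) denominator-1 i))))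

    denominator-*-≥2 : ∀ n → coeff ((D * F) (suc (suc n))) i ≡
      coeff (F (suc (suc n))) i ℤ.+ (coeff (-ₚ (f +ₚ g) *ₚ F (suc n)) i ℤ.+ coeff (-ₚ h *ₚ F n) i)
    denominator-*-≥2 n = trans (coeff-+ₚ (D 0 *ₚ F (suc (suc n))) _ i) (cong₂ ℤ._+_
      (trans (*ₚ-congˡ {D 0} {1ₚ} (F (suc (suc n))) denominator-0 i) (*ₚ-identityˡ (F (suc (suc n))) i))
      (trans (coeff-+ₚ (D 1 *ₚ F (suc n)) _ i) (cong₂ ℤ._+_
        (*ₚ-congˡ {D 1} { -ₚ (f +ₚ g)} (F (suc n)) denominator-1 i)
        (trans (coeff-+ₚ (D 2 *ₚ F n) _ i) (trans
          (cong₂ ℤ._+_ (*ₚ-congˡ {D 2} { -ₚ h} (F n) denominator-2 i)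
            -- With `D 0`, `D 1` and `D 2` split off, the `n` remaining summands start at index 3.
            (sum-zero (λ j → D j *ₚ F (suc (suc n) ∸ j)) (_+_ 3) n
              (λ j → *ₚ-zeroˡ (D (suc (suc (suc j)))) _ (denominator-≥3 j)) i))
          (ℤ.+-identityʳ _))))))

-- From the recurrence to the inverse of the denominator

denominator-linear : ∀ a b → -ₚ (constₚ a +ₚ constₚ b *ₚ X) ≈ₚ ℤ.- a ∷ ℤ.- b ∷ []
denominator-linear a b zero          = eq a b
  where
  eq : ∀ a b → ℤ.- (a ℤ.+ (b ℤ.* 0ℤ ℤ.+ 0ℤ)) ≡ ℤ.- a
  eq = solve-∀
denominator-linear a b (suc zero)    = cong ℤ.-_ (ℤ.*-identityʳ b)
denominator-linear a b (suc (suc i)) = refl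

module _ (K L : ℤ) (F : PowerSeries) where

  private
    C : ℕ → ℕ → ℤ
    C n = coeff (F n)

    f g h : Poly
    f = constₚ K
    g = constₚ L *ₚ X
    h = 1ₚ +ₚ X

    D₁-*F-0 : ∀ n → coeff (-ₚ (f +ₚ g) *ₚ F n) 0 ≡ ℤ.- K ℤ.* C n 0
    D₁-*F-0 n = trans (*ₚ-congˡ { -ₚ (f +ₚ g)} {ℤ.- K ∷ ℤ.- L ∷ []} (F n) (denominator-linear K L) 0)
                      (coeff-linear-*ₚ-zero (ℤ.- K) (ℤ.- L) (F n))

    D₁-*F-suc : ∀ n i → coeff (-ₚ (f +ₚ g) *ₚ F n) (suc i) ≡ ℤ.- K ℤ.* C n (suc i) ℤ.+ ℤ.- L ℤ.* C n i
    D₁-*F-suc n i = trans (*ₚ-congˡ { -ₚ (f +ₚ g)} {ℤ.- K ∷ ℤ.- L ∷ []} (F n) (denominator-linear K L) (suc i))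
                          (coeff-linear-*ₚ-suc (ℤ.- K) (ℤ.- L) (F n) i)

  -- Multiplication by the denominator subtracts from each coefficient the right-hand side of its
  -- recurrence, so everything past `F 0` cancels.
  recurrence⇒≈1/ :
    F 0 ≈ₚ 1ₚ →
    C 1 0 ≡ K ℤ.* C 0 0 →
    (∀ p → C 1 (suc p) ≡ K ℤ.* C 0 (suc p) ℤ.+ L ℤ.* C 0 p) →
    (∀ n → C (suc (suc n)) 0 ≡ K ℤ.* C (suc n) 0 ℤ.+ C n 0) →
    (∀ n p → C (suc (suc n)) (suc p) ≡
             K ℤ.* C (suc n) (suc p) ℤ.+ (L ℤ.* C (suc n) p ℤ.+ (C n (suc p) ℤ.+ C n p))) →
    F ≈1/ denominator f g h
  recurrence⇒≈1/ r₀ r₁₀ r₁ r₂₀ r₂ zero i = trans (denominator-*-0 f g h F i) (r₀ i)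
  recurrence⇒≈1/ r₀ r₁₀ r₁ r₂₀ r₂ (suc zero) zero =
    trans (denominator-*-1 f g h F 0) (trans (cong₂ ℤ._+_ r₁₀ (D₁-*F-0 0)) (cancel K (C 0 0)))
    where
    cancel : ∀ k x → k ℤ.* x ℤ.+ ℤ.- k ℤ.* x ≡ 0ℤ
    cancel = solve-∀
  recurrence⇒≈1/ r₀ r₁₀ r₁ r₂₀ r₂ (suc zero) (suc i) =
    trans (denominator-*-1 f g h F (suc i))
      (trans (cong₂ ℤ._+_ (r₁ i) (D₁-*F-suc 0 i)) (cancel K L (C 0 (suc i)) (C 0 i)))
    where
    cancel : ∀ k l x y → k ℤ.* x ℤ.+ l ℤ.* y ℤ.+ (ℤ.- k ℤ.* x ℤ.+ ℤ.- l ℤ.* y) ≡ 0ℤ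
    cancel = solve-∀
  recurrence⇒≈1/ r₀ r₁₀ r₁ r₂₀ r₂ (suc (suc n)) zero =
    trans (denominator-*-≥2 f g h F 0 n)
      -- `-ₚ h` evaluates to `-1ℤ ∷ -1ℤ ∷ []`, so the linear formula applies to it as it stands.
      (trans (cong₂ ℤ._+_ (r₂₀ n) (cong₂ ℤ._+_ (D₁-*F-0 (suc n)) (coeff-linear-*ₚ-zero -1ℤ -1ℤ (F n))))
        (cancel K (C (suc n) 0) (C n 0)))
    where
    cancel : ∀ k x y → k ℤ.* x ℤ.+ y ℤ.+ (ℤ.- k ℤ.* x ℤ.+ -1ℤ ℤ.* y) ≡ 0ℤ
    cancel = solve-∀
  recurrence⇒≈1/ r₀ r₁₀ r₁ r₂₀ r₂ (suc (suc n)) (suc i) =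
    trans (denominator-*-≥2 f g h F (suc i) n)
      (trans (cong₂ ℤ._+_ (r₂ n i) (cong₂ ℤ._+_ (D₁-*F-suc (suc n) i) (coeff-linear-*ₚ-suc -1ℤ -1ℤ (F n) i)))
        (cancel K L (C (suc n) (suc i)) (C (suc n) i) (C n (suc i)) (C n i)))
    where
    cancel : ∀ k l x y z w → k ℤ.* x ℤ.+ (l ℤ.* y ℤ.+ (z ℤ.+ w)) ℤ.+
             (ℤ.- k ℤ.* x ℤ.+ ℤ.- l ℤ.* y ℤ.+ (-1ℤ ℤ.* z ℤ.+ -1ℤ ℤ.* w)) ≡ 0ℤ
    cancel = solve-∀

theorem4p4 : (k : ℕ) → .{{_ : NonZero k}} →
    (λ n → cubePolynomial (munarini n k))
    ≈1/ (1ₛ - constₛ (constₚ (+ k)) * t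
    - constₛ (constₚ (+ (k ∸ 1)) *ₚ X) * t
    - constₛ (1ₚ +ₚ X) * (t * t))
-- For `k = suc m` the term `k ∸ 1` computes to `m`, and the series of the statement unfolds to the
-- `denominator` of the recurrence.
theorem4p4 (suc m) = recurrence⇒≈1/ K L F
  -- `c 0 p` computes to 1 at `p = 0` and to 0 elsewhere, which are the coefficients of `1ₚ`.
  (λ { zero → coeff-F 0 0 ; (suc i) → coeff-F 0 (suc i) })
  (trans (coeff-F 1 0) (trans (cong +_ (length-cubes-1-0 {m})) (K* 0 0)))
  (λ p → begin
    C 1 (suc p)                                   ≡⟨ coeff-F 1 (suc p) ⟩
    + c 1 (suc p)                                 ≡⟨ cong +_ (length-cubes-1-suc {m} p) ⟩
    + (suc m · c 0 (suc p)) ℤ.+ + (m · c 0 p)     ≡⟨ cong₂ ℤ._+_ (K* 0 (suc p)) (L* 0 p) ⟩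
    K ℤ.* C 0 (suc p) ℤ.+ L ℤ.* C 0 p             ∎)
  (λ n → begin
    C (suc (suc n)) 0                             ≡⟨ coeff-F (suc (suc n)) 0 ⟩
    + c (suc (suc n)) 0                           ≡⟨ cong +_ (length-cubes-0 {m} n) ⟩
    + (suc m · c (suc n) 0) ℤ.+ + c n 0           ≡⟨ cong₂ ℤ._+_ (K* (suc n) 0) (sym (coeff-F n 0)) ⟩
    K ℤ.* C (suc n) 0 ℤ.+ C n 0                   ∎)
  (λ n p → begin
    C (suc (suc n)) (suc p)
      ≡⟨ coeff-F (suc (suc n)) (suc p) ⟩
    + c (suc (suc n)) (suc p)
      ≡⟨ cong +_ (length-cubes-suc {m} n p) ⟩
    + (suc m · c (suc n) (suc p)) ℤ.+ (+ (m · c (suc n) p) ℤ.+ (+ c n (suc p) ℤ.+ + c n p))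
      ≡⟨ cong₂ ℤ._+_ (K* (suc n) (suc p)) (cong₂ ℤ._+_ (L* (suc n) p)
           (cong₂ ℤ._+_ (sym (coeff-F n (suc p))) (sym (coeff-F n p)))) ⟩
    K ℤ.* C (suc n) (suc p) ℤ.+ (L ℤ.* C (suc n) p ℤ.+ (C n (suc p) ℤ.+ C n p))
      ∎)
  where
  open ≡-Reasoning

  K L : ℤ
  K = + suc m
  L = + m

  F : PowerSeries
  F n = cubePolynomial (munarini n (suc m))

  C : ℕ → ℕ → ℤ
  C n = coeff (F n)

  c : ℕ → ℕ → ℕ
  c n p = length (cubes {m} n p)

  coeff-F : ∀ n p → C n p ≡ + c n p
  coeff-F n p = trans (coeff-cubePolynomial (munarini n (suc m)) p) (cong +_ (cubeCount≡length-cubes n p))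

  K* : ∀ n p → + (suc m · c n p) ≡ K ℤ.* C n p
  K* n p = trans (ℤ.pos-* (suc m) (c n p)) (cong (K ℤ.*_) (sym (coeff-F n p)))

  L* : ∀ n p → + (m · c n p) ≡ L ℤ.* C n p
  L* n p = trans (ℤ.pos-* m (c n p)) (cong (L ℤ.*_) (sym (coeff-F n p)))
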